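{- For every integer $n\ge 3$, $$\rho(F_2(C_n))\ \ge\ \left\lfloor\frac{n(n-2)}{10}\right\rfloor+1 .$$
   Context: $C_n$ is the cycle graph on $n$ vertices. For a simple graph $G$, the $2$-token graph $F_2(G)$ is the graph whose vertices are all the $2$-element subsets of $V(G)$, where two vertices $A,B$ are adjacent if and only if their symmetric difference $A\triangle B$ is (the vertex set of) an edge of $G$. A set $P\subseteq V(H)$ of vertices of a graph $H$ is a packing set if $d_H(x,y)\ge 3$ for all distinct $x,y\in P$, where $d_H$ is the graph distance. The packing number $\rho(H)$ is the maximum size of a packing set of $H$. -}

module Defs where

open import Data.Fin.Base using (Fin; toℕ)
import Data.Fin.Base as Fin
import Data.Fin.Properties as Fin
open import Data.Fin.Subset using (Subset; inside; outside; ∣_∣; ⁅_⁆; _∪_; _─_)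
import Data.Fin.Subset as Subset
open import Data.Fin.Subset.Properties using (∪-comm; x∈⁅x⁆; x∈p∪q⁺; x∈p∪q⁻)
open import Data.Bool.Properties using () renaming (_≟_ to _≟ᵇ_)
open import Data.List.Base using (List; []; _∷_; _++_; length; lookup; map; concatMap)
open import Data.List.Membership.Propositional using (_∈_; lose)
open import Data.List.Membership.Propositional.Properties
  using (∈-map⁺; ∈-++⁺ˡ; ∈-++⁺ʳ; ∈-concatMap⁺; ∈-lookup)
open import Data.List.Relation.Unary.All using (all?)
import Data.List.Relation.Unary.All as All
open import Data.List.Relation.Unary.AllPairs using (allPairs?; []; _∷_)
open import Data.List.Relation.Unary.Any using (here; there; index)
import Data.List.Relation.Unary.Any as Any
open import Data.List.Relation.Unary.Any.Properties using (lookup-index)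
open import Data.List.Relation.Unary.Unique.Propositional using (Unique)
open import Data.Nat.Base using (ℕ; zero; suc; _≤_; s≤s)
open import Data.Nat.Properties
  using (_≟_; ≡-irrelevant; allUpTo?; ≮⇒≥; <⇒≱; ≤-pred; ≤∧≢⇒<; 1+n≢n)
open import Data.Product.Base using (Σ; Σ-syntax; ∃; ∃-syntax; _×_; _,_; proj₁; proj₂)
open import Data.Sum.Base using (_⊎_; inj₁; inj₂; swap; [_,_]′)
open import Data.Vec.Base using (here; there; []; _∷_)
import Data.Vec.Properties as Vec
open import Function.Base using (_∘_)
open import Level using (0ℓ)
open import Relation.Binary.Core using (Rel)
open import Relation.Binary.Definitions using (DecidableEquality; Decidable; Symmetric; Irreflexive)
open import Relation.Binary.PropositionalEquality using (_≡_; _≢_; refl; sym; trans; cong; subst)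
open import Relation.Nullary using (¬_; Dec; yes; no; contradiction)
open import Relation.Nullary.Decidable using (map′; ¬?; _×-dec_; _⊎-dec_; _→-dec_)
import Relation.Unary as U

private
  variable
    V : Set
    n : ℕ

record Finite (V : Set) : Set where
  field
    _≟ⱽ_     : DecidableEquality V
    elements : List V
    complete : ∀ v → v ∈ elements

  ∃? : {P : V → Set} → U.Decidable P → Dec (∃ P)
  ∃? P? = map′ Any.satisfied (λ (v , p) → lose (complete v) p) (Any.any? P? elements)

-- Adjacency is required to be decidable so that ρ, a maximum, exists
-- constructively.
record Graph (V : Set) : Set₁ where
  infix 4 _∼_
  field
    _∼_      : Rel V 0ℓ
    _∼?_     : Decidable _∼_
    ∼-sym    : Symmetric _∼_
    ∼-irrefl : Irreflexive _≡_ _∼_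

module _ (G : Graph V) where
  open Graph G

  data Walk : V → V → ℕ → Set where
    []  : ∀ {x} → Walk x x 0
    _∷_ : ∀ {x y z k} → x ∼ y → Walk y z k → Walk x z (suc k)

  IsDistance : V → V → ℕ → Set
  IsDistance x y d = Walk x y d × (∀ k → Walk x y k → d ≤ k)

  -- Vertices with no walk between them are at infinite distance, and so
  -- satisfy this for every m.
  Distance≥ : ℕ → V → V → Set
  Distance≥ m x y = ∀ d → IsDistance x y d → m ≤ d

  IsPacking : List V → Set
  IsPacking P = ∀ x y → x ∈ P → y ∈ P → x ≢ y → Distance≥ 3 x y

  -- A set of k vertices is a duplicate-free list of length k.
  PackingOfSize : ℕ → Set
  PackingOfSize k = ∃[ P ] Unique P × IsPacking P × length P ≡ k

  IsPackingNumber : ℕ → Set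
  IsPackingNumber r = PackingOfSize r × (∀ {k} → PackingOfSize k → k ≤ r)

module _ {{fin : Finite V}} (G : Graph V) where
  open Finite fin
  open Graph G

  private
    walk? : ∀ k x y → Dec (Walk G x y k)
    walk? zero    x y = map′ (λ { refl → [] }) (λ { [] → refl }) (x ≟ⱽ y)
    walk? (suc k) x z =
      map′ (λ { (_ , e , w) → e ∷ w }) (λ { (e ∷ w) → _ , e , w })
           (∃? (λ y → (x ∼? y) ×-dec walk? k y z))

    isDistance? : ∀ x y d → Dec (IsDistance G x y d)
    isDistance? x y d = walk? d x y ×-dec
      map′ (λ none k w → ≮⇒≥ (λ k<d → none k<d w))
           (λ least {k} k<d w → <⇒≱ k<d (least k w))
           (allUpTo? (λ k → ¬? (walk? k x y)) d)

    distance≥? : ∀ m x y → Dec (Distance≥ G m x y)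
    distance≥? m x y =
      map′ (λ none d δ → ≮⇒≥ (λ d<m → none d<m δ))
           (λ far {d} d<m δ → <⇒≱ d<m (far d δ))
           (allUpTo? (λ d → ¬? (isDistance? x y d)) m)

    isPacking? : U.Decidable (IsPacking G)
    isPacking? P =
      map′ (λ ps x y x∈ y∈ → All.lookup (All.lookup ps x∈) y∈)
           (λ p → All.tabulate λ x∈ → All.tabulate λ y∈ → p _ _ x∈ y∈)
           (all? (λ x → all? (λ y → ¬? (x ≟ⱽ y) →-dec distance≥? 3 x y) P) P)

    ∃-length? : ∀ k {Q : List V → Set} → U.Decidable Q → Dec (∃[ P ] Q P × length P ≡ k)
    ∃-length? zero Q? =
      map′ (λ q → [] , q , refl) (λ { ([] , q , _) → q }) (Q? [])
    ∃-length? (suc k) Q? =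
      map′ (λ { (v , P , q , refl) → v ∷ P , q , refl })
           (λ { (v ∷ P , q , refl) → v , P , q , refl })
           (∃? (λ v → ∃-length? k (Q? ∘ (v ∷_))))

    packingOfSize? : U.Decidable (PackingOfSize G)
    packingOfSize? k =
      map′ (λ { (P , (u , p) , e) → P , u , p , e })
           (λ { (P , u , p , e) → P , (u , p) , e })
           (∃-length? k (λ P → allPairs? (λ x y → ¬? (x ≟ⱽ y)) P ×-dec isPacking? P))

    lookup-injective : ∀ {P : List V} → Unique P → ∀ i j → lookup P i ≡ lookup P j → i ≡ j
    lookup-injective (_  ∷ _) Fin.zero    Fin.zero    _ = refl
    lookup-injective (v∉ ∷ _) Fin.zero    (Fin.suc j) e = contradiction e (All.lookup v∉ (∈-lookup j))
    lookup-injective (v∉ ∷ _) (Fin.suc i) Fin.zero    e = contradiction (sym e) (All.lookup v∉ (∈-lookup i))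
    lookup-injective (_  ∷ u) (Fin.suc i) (Fin.suc j) e = cong Fin.suc (lookup-injective u i j e)

    size-bounded : ∀ {k} → PackingOfSize G k → k ≤ length elements
    size-bounded (P , u , _ , refl) = Fin.injective⇒≤ {f = position} position-injective
      where
      position : Fin (length P) → Fin (length elements)
      position i = index (complete (lookup P i))

      position-injective : ∀ {i j} → position i ≡ position j → i ≡ j
      position-injective {i} {j} e = lookup-injective u i j
        (trans (lookup-index (complete (lookup P i)))
               (trans (cong (lookup elements) e) (sym (lookup-index (complete (lookup P j))))))

    greatest : {Q : ℕ → Set} → U.Decidable Q → Q 0 → ∀ b → (∀ {k} → Q k → k ≤ b) →
               ∃[ r ] Q r × (∀ {k} → Q k → k ≤ r)
    greatest Q? q₀ zero    ≤b = 0 , q₀ , ≤b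
    greatest Q? q₀ (suc b) ≤b with Q? (suc b)
    ... | yes q = suc b , q , ≤b
    ... | no ¬q = greatest Q? q₀ b
                    (λ q → ≤-pred (≤∧≢⇒< (≤b q) (λ { refl → ¬q q })))

  packingNumber : Σ ℕ (IsPackingNumber G)
  packingNumber = greatest packingOfSize? ([] , [] , (λ _ _ ()) , refl) (length elements) size-bounded

  ρ : ℕ
  ρ = proj₁ packingNumber

Next : Fin n → Fin n → Set
Next {n} i j = suc (toℕ i) ≡ toℕ j ⊎ (suc (toℕ i) ≡ n × toℕ j ≡ 0)

C : ∀ n → 3 ≤ n → Graph (Fin n)
C n 3≤n = record
  { _∼_      = λ i j → Next i j ⊎ Next j i
  ; _∼?_     = λ i j → next? i j ⊎-dec next? j i
  ; ∼-sym    = swap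
  ; ∼-irrefl = λ { refl → [ irrefl 3≤n , irrefl 3≤n ]′ }
  }
  where
  next? : Decidable (Next {n})
  next? i j = (suc (toℕ i) ≟ toℕ j) ⊎-dec ((suc (toℕ i) ≟ n) ×-dec (toℕ j ≟ 0))

  irrefl : 3 ≤ n → ∀ {i} → ¬ Next {n} i i
  irrefl _   (inj₁ e)       = 1+n≢n e
  irrefl 3≤n (inj₂ (e , z)) with trans (sym e) (cong suc z)
  irrefl (s≤s ()) (inj₂ _) | refl

TwoSubset : ℕ → Set
TwoSubset n = Σ[ A ∈ Subset n ] ∣ A ∣ ≡ 2

infixl 6 _△_

_△_ : Subset n → Subset n → Subset n
A △ B = (A ─ B) ∪ (B ─ A)

F₂ : Graph (Fin n) → Graph (TwoSubset n)
F₂ {n} G = record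
  { _∼_      = λ A B → IsEdge (proj₁ A △ proj₁ B)
  ; _∼?_     = λ A B → Fin.any? λ u → Fin.any? λ v →
                 (u ∼? v) ×-dec Vec.≡-dec _≟ᵇ_ (proj₁ A △ proj₁ B) (⁅ u ⁆ ∪ ⁅ v ⁆)
  ; ∼-sym    = λ { {A , _} {B , _} (u , v , e , eq) → u , v , e , trans (∪-comm (B ─ A) (A ─ B)) eq }
  ; ∼-irrefl = λ { {A , _} refl (u , v , _ , eq) →
                 ∉A△A A (subst (u Subset.∈_) (sym eq) (x∈p∪q⁺ (inj₁ (x∈⁅x⁆ u)))) }
  }
  where
  open Graph G

  IsEdge : Subset n → Set
  IsEdge S = ∃[ u ] ∃[ v ] u ∼ v × S ≡ ⁅ u ⁆ ∪ ⁅ v ⁆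

  ∉A─A : ∀ {m} (A : Subset m) {x} → ¬ (x Subset.∈ A ─ A)
  ∉A─A (inside  ∷ A) (there x∈) = ∉A─A A x∈
  ∉A─A (outside ∷ A) (there x∈) = ∉A─A A x∈

  ∉A△A : ∀ (A : Subset n) {x} → ¬ (x Subset.∈ A △ A)
  ∉A△A A x∈ = [ ∉A─A A , ∉A─A A ]′ (x∈p∪q⁻ (A ─ A) (A ─ A) x∈)

private
  subsets : ∀ n → List (Subset n)
  subsets zero    = [] ∷ []
  subsets (suc n) = map (inside ∷_) (subsets n) ++ map (outside ∷_) (subsets n)

  ∈-subsets : ∀ (A : Subset n) → A ∈ subsets n
  ∈-subsets []            = here refl
  ∈-subsets (inside  ∷ A) = ∈-++⁺ˡ (∈-map⁺ (inside ∷_) (∈-subsets A))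
  ∈-subsets (outside ∷ A) = ∈-++⁺ʳ (map (inside ∷_) (subsets _)) (∈-map⁺ (outside ∷_) (∈-subsets A))

  ifTwo : Subset n → List (TwoSubset n)
  ifTwo A with ∣ A ∣ ≟ 2
  ... | yes e = (A , e) ∷ []
  ... | no  _ = []

  ∈-ifTwo : ∀ ((A , e) : TwoSubset n) → (A , e) ∈ ifTwo A
  ∈-ifTwo (A , e) with ∣ A ∣ ≟ 2
  ... | yes e′ = here (cong (A ,_) (≡-irrelevant e e′))
  ... | no  ¬e = contradiction e ¬e

instance
  twoSubset-finite : Finite (TwoSubset n)
  twoSubset-finite {n} = record
    { _≟ⱽ_     = λ { (A , e) (B , f) →
                   map′ (λ { refl → cong (A ,_) (≡-irrelevant e f) }) (cong proj₁)
                        (Vec.≡-dec _≟ᵇ_ A B) }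
    ; elements = concatMap ifTwo (subsets n)
    ; complete = λ A → ∈-concatMap⁺ ifTwo (lose (∈-subsets (proj₁ A)) (∈-ifTwo A))
    }

{-# OPTIONS --safe #-}
module Submission where

open import Defs hiding ([]; _∷_)
open import Data.Empty using (⊥)
open import Data.Fin.Base as Fin using (Fin; toℕ; fromℕ<)
open import Data.Fin.Patterns
import Data.Fin.Properties as Fin
open import Data.Fin.Subset as Subset using (Subset; inside; outside; ⁅_⁆; _∪_; _─_)
open import Data.Fin.Subset.Properties
  using (∪-comm; ∪-identityˡ; ∪-identityʳ; ∣⁅x⁆∣≡1; x∈⁅x⁆; x∈⁅y⁆⇒x≡y; x∈p∪q⁺; x∈p∪q⁻;
         x∈p∧x∉q⇒x∈p─q; p─q⊆p; _∈?_)
open import Data.List.Base using (List; []; _∷_; length; applyUpTo; concatMap; map)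
open import Data.List.Membership.Propositional using (_∈_; find)
open import Data.List.Membership.Propositional.Properties using (∈-concatMap⁻; ∈-applyUpTo⁻)
open import Data.List.Properties using (length-++; length-applyUpTo; map-applyUpTo; map-cong)
open import Data.List.Relation.Binary.Disjoint.Propositional using (Disjoint)
open import Data.List.Relation.Unary.All as All using (All)
import Data.List.Relation.Unary.All.Properties as All
open import Data.List.Relation.Unary.AllPairs as AllPairs using (AllPairs)
import Data.List.Relation.Unary.AllPairs.Properties as AllPairs
open import Data.List.Relation.Unary.Any using (here; there)
open import Data.List.Relation.Unary.Unique.Propositional using (Unique)
import Data.List.Relation.Unary.Unique.Propositional.Properties as Unique
open import Data.Nat.Base
open import Data.Nat.Divisibility
  using (_∣_; divides; _∣?_; m∣m*n; ∣n⇒∣m*n; ∣m∣n⇒∣m+n; ∣m+n∣m⇒∣n)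
open import Data.Nat.DivMod
open import Data.Nat.ListAction using (sum)
open import Data.Nat.Properties
open import Data.Nat.Tactic.RingSolver using (solve)
open import Data.Product.Base using (Σ-syntax; ∃-syntax; _×_; _,_; proj₁; proj₂)
open import Data.Sum.Base as Sum using (_⊎_; inj₁; inj₂; swap; [_,_]′)
open import Data.Unit.Base using (⊤; tt)
import Data.Vec.Base as Vec
open import Function.Base using (_∘_; id; case_of_)
open import Relation.Binary.PropositionalEquality
open import Relation.Nullary using (¬_; Dec; yes; no; contradiction)
open import Relation.Nullary.Decidable
  using (True; False; toWitness; toWitnessFalse; _×-dec_; _⊎-dec_)
open import Algebra.Properties.CommutativeSemigroup +-commutativeSemigroup
  using (x∙yz≈y∙xz; xy∙z≈xz∙y)

-- Write a vertex {a < b} of F₂(Cₙ) as u = a + b - τ, e = b - a if a + b < n + τ, and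
-- as u = a + b - τ - n, e = n - (b - a) otherwise.  This makes F₂(Cₙ) a Möbius strip:
-- its vertices are the cells 0 ≤ u < n, 0 < e < n with u + τ + e even, its edges are
-- the diagonal steps, and column n is glued to column 0 by (n , e) = (0 , n - e).
-- The cells with 5 ∣ u + 2e + n + 4 form a perfect code of the plane.  The gluing
-- reverses its chirality, but with this choice of offset all conflicts across the
-- seam disappear once column 0 is deleted, at a cost of about n/10 cells.  For one of
-- the parities τ ∈ {0 , 1} the remaining code is large enough, unless n is 0 or 2
-- modulo 10.  In these two cases one further cell is gained by rearranging the code
-- in the three rows next to the boundary of the strip.

private
  variable
    n : ℕ

-- Two-element subsets and moves of a single token.

pair : Fin n → Fin n → Subset n
pair i j = ⁅ i ⁆ ∪ ⁅ j ⁆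

∣pair∣≡2 : {i j : Fin n} → i ≢ j → Subset.∣ pair i j ∣ ≡ 2
∣pair∣≡2 {i = Fin.zero}  {Fin.zero}  i≢j = contradiction refl i≢j
∣pair∣≡2 {i = Fin.zero}  {Fin.suc j} i≢j = cong suc (trans (cong Subset.∣_∣ (∪-identityˡ ⁅ j ⁆)) (∣⁅x⁆∣≡1 j))
∣pair∣≡2 {i = Fin.suc i} {Fin.zero}  i≢j = cong suc (trans (cong Subset.∣_∣ (∪-identityʳ ⁅ i ⁆)) (∣⁅x⁆∣≡1 i))
∣pair∣≡2 {i = Fin.suc i} {Fin.suc j} i≢j = ∣pair∣≡2 (i≢j ∘ cong Fin.suc)

∣p∣≡0⇒p≡⊥ : (p : Subset n) → Subset.∣ p ∣ ≡ 0 → p ≡ Subset.⊥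
∣p∣≡0⇒p≡⊥ Vec.[]            _ = refl
∣p∣≡0⇒p≡⊥ (outside Vec.∷ p) e = cong (outside Vec.∷_) (∣p∣≡0⇒p≡⊥ p e)

∣p∣≡1⇒singleton : (p : Subset n) → Subset.∣ p ∣ ≡ 1 → ∃[ i ] p ≡ ⁅ i ⁆
∣p∣≡1⇒singleton (inside  Vec.∷ p) e = Fin.zero , cong (inside Vec.∷_) (∣p∣≡0⇒p≡⊥ p (suc-injective e))
∣p∣≡1⇒singleton (outside Vec.∷ p) e with i , refl ← ∣p∣≡1⇒singleton p e = Fin.suc i , refl

∣p∣≡2⇒pair : (p : Subset n) → Subset.∣ p ∣ ≡ 2 → ∃[ i ] ∃[ j ] toℕ i < toℕ j × p ≡ pair i j
∣p∣≡2⇒pair (inside Vec.∷ p) e with j , refl ← ∣p∣≡1⇒singleton p (suc-injective e) =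
  Fin.zero , Fin.suc j , z<s , cong (inside Vec.∷_) (sym (∪-identityˡ ⁅ j ⁆))
∣p∣≡2⇒pair (outside Vec.∷ p) e with i , j , i<j , refl ← ∣p∣≡2⇒pair p e =
  Fin.suc i , Fin.suc j , s<s i<j , refl

x∈pair⁻ : (i j : Fin n) → ∀ {x} → x Subset.∈ pair i j → x ≡ i ⊎ x ≡ j
x∈pair⁻ i j = Sum.map (x∈⁅y⁆⇒x≡y i) (x∈⁅y⁆⇒x≡y j) ∘ x∈p∪q⁻ ⁅ i ⁆ ⁅ j ⁆

x∈pair⁺ : (i j : Fin n) → ∀ {x} → x ≡ i ⊎ x ≡ j → x Subset.∈ pair i j
x∈pair⁺ i j (inj₁ refl) = x∈p∪q⁺ (inj₁ (x∈⁅x⁆ i))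
x∈pair⁺ i j (inj₂ refl) = x∈p∪q⁺ (inj₂ (x∈⁅x⁆ j))

x∈p─q⇒x∉q : (p q : Subset n) → ∀ {x} → x Subset.∈ p ─ q → x Subset.∉ q
x∈p─q⇒x∉q (inside  Vec.∷ p) (inside  Vec.∷ q) {Fin.zero} () Vec.here
x∈p─q⇒x∉q (outside Vec.∷ p) (inside  Vec.∷ q) {Fin.zero} () Vec.here
x∈p─q⇒x∉q (_ Vec.∷ p) (inside  Vec.∷ q) (Vec.there x∈) (Vec.there x∈q) = x∈p─q⇒x∉q p q x∈ x∈q
x∈p─q⇒x∉q (_ Vec.∷ p) (outside Vec.∷ q) (Vec.there x∈) (Vec.there x∈q) = x∈p─q⇒x∉q p q x∈ x∈q

SamePair : Fin n → Fin n → Fin n → Fin n → Set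
SamePair i j u w = (i ≡ u × j ≡ w) ⊎ (i ≡ w × j ≡ u)

samePair : {i j u w : Fin n} → u ≡ i ⊎ u ≡ j → w ≡ i ⊎ w ≡ j → u ≢ w → SamePair i j u w
samePair (inj₁ refl) (inj₁ refl) u≢w = contradiction refl u≢w
samePair (inj₁ refl) (inj₂ refl) u≢w = inj₁ (refl , refl)
samePair (inj₂ refl) (inj₁ refl) u≢w = inj₂ (refl , refl)
samePair (inj₂ refl) (inj₂ refl) u≢w = contradiction refl u≢w

-- The token on `u` moves to `v`, while the token on `w` stays in place.
TokenMove : (i j k l u v : Fin n) → Set
TokenMove i j k l u v = ∃[ w ] SamePair i j u w × SamePair k l v w

module _ {i j k l : Fin n} (i≢j : i ≢ j) where

  private
    A = pair i j
    B = pair k l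

    other : ∀ {u} → u ≡ i ⊎ u ≡ j → ∃[ w ] u ≢ w × (w ≡ i ⊎ w ≡ j)
    other (inj₁ refl) = j , i≢j , inj₂ refl
    other (inj₂ refl) = i , i≢j ∘ sym , inj₁ refl

  -- If `v` were in `A` too, then `A` would be `pair u v`, and `k`, which lies in `B`, would be a
  -- third element of the symmetric difference. So `v` is in `B`, and the other element of `A` must
  -- survive in `B`, since otherwise it would be that third element.
  △-move : ∀ {u v} → u ≢ v → A △ B ≡ pair u v →
           u Subset.∈ A → u Subset.∉ B → TokenMove i j k l u v
  △-move {u} {v} u≢v eq u∈A u∉B
    with x∈p∪q⁻ (A ─ B) (B ─ A) (subst (v Subset.∈_) (sym eq) (x∈pair⁺ u v (inj₂ refl)))
  ... | inj₁ v∈A─B = contradiction k∈D (k∉D ∘ x∈pair⁻ u v ∘ subst (k Subset.∈_) eq)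
    where
    v∈A : v Subset.∈ A
    v∈A = p─q⊆p A B v∈A─B

    k∈B : k Subset.∈ B
    k∈B = x∈pair⁺ k l (inj₁ refl)

    k∉D : ¬ (k ≡ u ⊎ k ≡ v)
    k∉D (inj₁ refl) = u∉B k∈B
    k∉D (inj₂ refl) = x∈p─q⇒x∉q A B v∈A─B k∈B

    k∉A : k Subset.∉ A
    k∉A k∈A with samePair (x∈pair⁻ i j u∈A) (x∈pair⁻ i j v∈A) u≢v
    ... | inj₁ (refl , refl) = k∉D (x∈pair⁻ i j k∈A)
    ... | inj₂ (refl , refl) = k∉D (swap (x∈pair⁻ i j k∈A))

    k∈D : k Subset.∈ A △ B
    k∈D = x∈p∪q⁺ (inj₂ (x∈p∧x∉q⇒x∈p─q k∈B k∉A))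
  ... | inj₂ v∈B─A with w , u≢w , w∈ ← other (x∈pair⁻ i j u∈A) =
    w , samePair (x∈pair⁻ i j u∈A) w∈ u≢w
      , samePair (x∈pair⁻ k l (p─q⊆p B A v∈B─A)) (x∈pair⁻ k l w∈B) v≢w
    where
    w∈A : w Subset.∈ A
    w∈A = x∈pair⁺ i j w∈

    v≢w : v ≢ w
    v≢w refl = x∈p─q⇒x∉q B A v∈B─A w∈A

    w∈B : w Subset.∈ B
    w∈B with w ∈? B
    ... | yes p = p
    ... | no w∉B with x∈pair⁻ u v (subst (w Subset.∈_) eq (x∈p∪q⁺ (inj₁ (x∈p∧x∉q⇒x∈p─q w∈A w∉B))))
    ...   | inj₁ w≡u = contradiction (sym w≡u) u≢w
    ...   | inj₂ w≡v = contradiction (sym w≡v) v≢w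

edge-move : {i j k l u v : Fin n} → i ≢ j → k ≢ l → u ≢ v →
            pair i j △ pair k l ≡ pair u v →
            TokenMove i j k l u v ⊎ TokenMove k l i j u v
edge-move {i = i} {j} {k} {l} {u} {v} i≢j k≢l u≢v eq
  with x∈p∪q⁻ (pair i j ─ pair k l) (pair k l ─ pair i j)
              (subst (u Subset.∈_) (sym eq) (x∈pair⁺ u v (inj₁ refl)))
... | inj₁ u∈ = inj₁ (△-move i≢j u≢v eq (p─q⊆p (pair i j) (pair k l) u∈)
                                        (x∈p─q⇒x∉q (pair i j) (pair k l) u∈))
... | inj₂ u∈ = inj₂ (△-move k≢l u≢v
                        (trans (∪-comm (pair k l ─ pair i j) (pair i j ─ pair k l)) eq)
                        (p─q⊆p (pair k l) (pair i j) u∈) (x∈p─q⇒x∉q (pair k l) (pair i j) u∈))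

-- Coordinates and steps on the Möbius strip.

-- Linear arithmetic: a ≡ b is a sum of hypotheses, and the remaining premise is a
-- semiring identity.
cancel-by : ∀ {a b x y} → a ≡ b → x + b ≡ y + a → x ≡ y
cancel-by {a} {x = x} {y} refl eq = +-cancelʳ-≡ a x y eq

absurd : ∀ {a b x} {A : Set} → a ≡ b → suc x + b ≡ a → A
absurd {a} {x = x} refl eq = contradiction (trans (+-comm a (suc x)) eq) (m+1+n≢m a)

-- Turns a strict inequality into an equation, so that it can be one of the summed hypotheses.
with-slack : ∀ {m n} {A : Set} → m < n → (∀ o → suc m + o ≡ n → A) → A
with-slack m<n k = case m≤n⇒∃[o]m+o≡n m<n of λ (o , eq) → k o eq

data Coord (n τ a b u e : ℕ) : Set where
  lower : u + τ ≡ a + b → a + e ≡ b → Coord n τ a b u e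
  upper : u + τ + n ≡ a + b → b + e ≡ a + n → Coord n τ a b u e

-- Steps are oriented towards the next column. `wrap⁺` is a `down` step into the glued column n,
-- whose row `e - 1` becomes `f = n - (e - 1)`; `wrap⁻` is likewise an `up` step. The rows are left
-- unbounded.
data Step (n : ℕ) : ℕ × ℕ → ℕ × ℕ → Set where
  up    : ∀ {u e} → Step n (u , e) (suc u , suc e)
  down  : ∀ {u e} → Step n (u , suc e) (suc u , e)
  wrap⁺ : ∀ {u e f} → suc u ≡ n → e + f ≡ suc n → Step n (u , e) (0 , f)
  wrap⁻ : ∀ {u e f} → suc u ≡ n → suc (e + f) ≡ n → Step n (u , e) (0 , f)

up≡ : ∀ {n u e v f} → v ≡ suc u → f ≡ suc e → Step n (u , e) (v , f)
up≡ refl refl = up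

down≡ : ∀ {n u e v f} → v ≡ suc u → e ≡ suc f → Step n (u , e) (v , f)
down≡ refl refl = down

last-column : ∀ {n u v} → u < n → v + n ≡ suc u → v ≡ 0 × suc u ≡ n
last-column {n} {u} {v} u<n eq = v≡0 , trans (sym eq) (cong (_+ n) v≡0)
  where
  v≡0 : v ≡ 0
  v≡0 = with-slack u<n λ o o-eq →
    m+n≡0⇒m≡0 v (cancel-by {x = v + o} {y = 0} (cong₂ _+_ eq o-eq) (solve (u ∷ v ∷ o ∷ n ∷ [])))

wrap⁺≡ : ∀ {n u e v f} → u < n → v + n ≡ suc u → e + f ≡ suc n → Step n (u , e) (v , f)
wrap⁺≡ u<n eq e+f with refl , last ← last-column u<n eq = wrap⁺ last e+f

wrap⁻≡ : ∀ {n u e v f} → u < n → v + n ≡ suc u → suc (e + f) ≡ n → Step n (u , e) (v , f)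
wrap⁻≡ u<n eq e+f with refl , last ← last-column u<n eq = wrap⁻ last e+f

module _ {n τ : ℕ} where

  lower-coord : ∀ {u e y a} → u + τ + e ≡ y + y → a + e ≡ y → Coord n τ a y u e
  lower-coord {u} {e} {y} {a} eq h =
    lower (cancel-by (cong₂ _+_ eq (sym h)) (solve (u ∷ τ ∷ a ∷ e ∷ y ∷ []))) h

  upper-coord : ∀ {u e y b} → u + τ + e ≡ y + y → b + e ≡ y + n → Coord n τ y b u e
  upper-coord {u} {e} {y} {b} eq h =
    upper (cancel-by (cong₂ _+_ eq (sym h)) (solve (u ∷ τ ∷ b ∷ e ∷ y ∷ n ∷ []))) h

  -- Raising an entry raises the sum by one, hence moves one column on; the seam is crossed when the
  -- sum reaches `n + τ`. The sum cannot fall back from upper to lower.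
  step-lower : ∀ {u e v f p w} → u < n → v < n →
               Coord n τ p w u e → Coord n τ (suc p) w v f → Step n (u , e) (v , f)
  step-lower {u} {e} {v} {f} {p} {w} _ _ (lower s d) (lower s′ d′)
    = down≡ (cancel-by {x = v} {y = suc u} (cong₂ _+_ s′ (sym s)) (solve (u ∷ v ∷ p ∷ w ∷ τ ∷ [])))
          (cancel-by {x = e} {y = suc f} (cong₂ _+_ d (sym d′)) (solve (e ∷ f ∷ p ∷ w ∷ τ ∷ [])))
  step-lower {u} {e} {v} {f} {p} {w} u<n _ (lower s d) (upper s′ d′)
    = wrap⁺≡ u<n (cancel-by (cong₂ _+_ s′ (sym s)) (solve (u ∷ v ∷ p ∷ w ∷ τ ∷ n ∷ [])))
          (cancel-by (cong₂ _+_ d d′) (solve (e ∷ f ∷ p ∷ w ∷ n ∷ [])))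
  step-lower {u} {e} {v} {f} {p} {w} _ v<n (upper s _) (lower s′ _)
    = with-slack v<n λ o o-eq → absurd {x = u + o + 1} (cong₂ _+_ (cong₂ _+_ s (sym s′)) o-eq)
           (solve (u ∷ v ∷ p ∷ w ∷ τ ∷ n ∷ o ∷ []))
  step-lower {u} {e} {v} {f} {p} {w} _ _ (upper s d) (upper s′ d′)
    = up≡ (cancel-by {x = v} {y = suc u} (cong₂ _+_ s′ (sym s)) (solve (u ∷ v ∷ p ∷ w ∷ τ ∷ n ∷ [])))
          (cancel-by {x = f} {y = suc e} (cong₂ _+_ (sym d) d′) (solve (e ∷ f ∷ p ∷ w ∷ n ∷ [])))

  step-higher : ∀ {u e v f p w} → u < n → v < n →
                Coord n τ w p u e → Coord n τ w (suc p) v f → Step n (u , e) (v , f)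
  step-higher {u} {e} {v} {f} {p} {w} _ _ (lower s d) (lower s′ d′)
    = up≡ (cancel-by {x = v} {y = suc u} (cong₂ _+_ s′ (sym s)) (solve (u ∷ v ∷ p ∷ w ∷ τ ∷ [])))
          (cancel-by {x = f} {y = suc e} (cong₂ _+_ (sym d) d′) (solve (e ∷ f ∷ p ∷ w ∷ τ ∷ [])))
  step-higher {u} {e} {v} {f} {p} {w} u<n _ (lower s d) (upper s′ d′)
    = wrap⁻≡ u<n (cancel-by (cong₂ _+_ s′ (sym s)) (solve (u ∷ v ∷ p ∷ w ∷ τ ∷ n ∷ [])))
          (cancel-by (cong₂ _+_ d d′) (solve (e ∷ f ∷ p ∷ w ∷ n ∷ [])))
  step-higher {u} {e} {v} {f} {p} {w} _ v<n (upper s _) (lower s′ _)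
    = with-slack v<n λ o o-eq → absurd {x = u + o + 1} (cong₂ _+_ (cong₂ _+_ s (sym s′)) o-eq)
           (solve (u ∷ v ∷ p ∷ w ∷ τ ∷ n ∷ o ∷ []))
  step-higher {u} {e} {v} {f} {p} {w} _ _ (upper s d) (upper s′ d′)
    = down≡ (cancel-by {x = v} {y = suc u} (cong₂ _+_ s′ (sym s)) (solve (u ∷ v ∷ p ∷ w ∷ τ ∷ n ∷ [])))
          (cancel-by {x = e} {y = suc f} (cong₂ _+_ d (sym d′)) (solve (e ∷ f ∷ p ∷ w ∷ n ∷ [])))

  -- The token on n - 1 moves to 0 and becomes the smaller one. The new sum is `w`, which is less
  -- than `n`, so the new pair is never upper.
  step-around : ∀ {u e v f p w} → suc p ≡ n → u < n → w < n →
                Coord n τ w p u e → Coord n τ 0 w v f → Step n (u , e) (v , f)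
  step-around {u} {e} {v} {f} {p} {w} refl u<n _ (lower s d) (lower s′ d′)
    = wrap⁻≡ u<n (cancel-by (cong₂ _+_ s′ (sym s)) (solve (u ∷ v ∷ p ∷ w ∷ τ ∷ [])))
          (cancel-by (cong₂ _+_ d d′) (solve (e ∷ f ∷ p ∷ w ∷ [])))
  step-around {u} {e} {v} {f} {p} {w} refl _ w<n (lower s d) (upper s′ d′)
    = with-slack w<n λ o o-eq → absurd {x = v + τ + o}
        (cong₂ _+_ s′ o-eq)
        (solve (v ∷ p ∷ w ∷ τ ∷ o ∷ []))
  step-around {u} {e} {v} {f} {p} {w} refl _ _ (upper s d) (lower s′ d′)
    = down≡ (cancel-by {x = v} {y = suc u} (cong₂ _+_ s′ (sym s)) (solve (u ∷ v ∷ p ∷ w ∷ τ ∷ [])))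
          (cancel-by {x = e} {y = suc f} (cong₂ _+_ d (sym d′)) (solve (e ∷ f ∷ p ∷ w ∷ [])))
  step-around {u} {e} {v} {f} {p} {w} refl _ w<n (upper s d) (upper s′ d′)
    = with-slack w<n λ o o-eq → absurd {x = v + τ + o}
        (cong₂ _+_ s′ o-eq)
        (solve (v ∷ p ∷ w ∷ τ ∷ o ∷ []))

  Coord-unique : ∀ {u e v f a b} → u < n → v < n →
                 Coord n τ a b u e → Coord n τ a b v f → (u , e) ≡ (v , f)
  Coord-unique {u} {e} {v} {f} {a} {b} _ _ (lower s d) (lower s′ d′)
    = cong₂ _,_ (cancel-by {x = u} {y = v} (cong₂ _+_ s (sym s′)) (solve (u ∷ v ∷ a ∷ b ∷ τ ∷ [])))
               (cancel-by {x = e} {y = f} (cong₂ _+_ d (sym d′)) (solve (e ∷ f ∷ a ∷ b ∷ [])))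
  Coord-unique {u} {e} {v} {f} {a} {b} u<n _ (lower s d) (upper s′ d′)
    = with-slack u<n λ o o-eq → absurd {x = v + o}
        (cong₂ _+_ (cong₂ _+_ (sym s) s′) o-eq)
        (solve (u ∷ v ∷ a ∷ b ∷ τ ∷ n ∷ o ∷ []))
  Coord-unique {u} {e} {v} {f} {a} {b} _ v<n (upper s d) (lower s′ d′)
    = with-slack v<n λ o o-eq → absurd {x = u + o}
        (cong₂ _+_ (cong₂ _+_ s (sym s′)) o-eq)
        (solve (u ∷ v ∷ a ∷ b ∷ τ ∷ n ∷ o ∷ []))
  Coord-unique {u} {e} {v} {f} {a} {b} _ _ (upper s d) (upper s′ d′)
    = cong₂ _,_ (cancel-by {x = u} {y = v} (cong₂ _+_ s (sym s′)) (solve (u ∷ v ∷ a ∷ b ∷ τ ∷ n ∷ [])))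
               (cancel-by {x = e} {y = f} (cong₂ _+_ d (sym d′)) (solve (e ∷ f ∷ a ∷ b ∷ n ∷ [])))

  -- `u + τ + e` is twice the larger entry of a lower pair and twice the smaller entry of an upper
  -- pair. In the mixed cases these entries coincide, but the lower pair needs `e` at most that
  -- entry and the upper pair needs `e` above it.
  Coord-injective : ∀ {u e a b a′ b′} → b < n → b′ < n →
                    Coord n τ a b u e → Coord n τ a′ b′ u e → a ≡ a′ × b ≡ b′
  Coord-injective {u} {e} {a} {b} {a′} {b′} _ _ (lower s d) (lower s′ d′)
    = a≡a′ , trans (sym d) (trans (cong (_+ e) a≡a′) d′)
    where
    a≡a′ : a ≡ a′
    a≡a′ = *-cancelˡ-≡ a a′ 2 (cancel-by (cong₂ _+_ (cong₂ _+_ (sym s) s′) (cong₂ _+_ d (sym d′)))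
                                  (solve (u ∷ e ∷ a ∷ b ∷ a′ ∷ b′ ∷ τ ∷ [])))
  Coord-injective {u} {e} {a} {b} {a′} {b′} _ b′<n (lower s d) (upper s′ d′)
    = with-slack b′<n λ o o-eq → absurd {x = a + a + o + o + 1}
      (cong₂ _+_ (cong₂ _+_ (sym s) s′) (cong₂ _+_ (cong₂ _+_ d (sym d′)) (cong₂ _+_ o-eq o-eq)))
      (solve (u ∷ e ∷ a ∷ b ∷ a′ ∷ b′ ∷ τ ∷ n ∷ o ∷ []))
  Coord-injective {u} {e} {a} {b} {a′} {b′} b<n _ (upper s d) (lower s′ d′)
    = with-slack b<n λ o o-eq → absurd {x = a′ + a′ + o + o + 1}
      (cong₂ _+_ (cong₂ _+_ (sym s′) s) (cong₂ _+_ (cong₂ _+_ d′ (sym d)) (cong₂ _+_ o-eq o-eq)))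
      (solve (u ∷ e ∷ a ∷ b ∷ a′ ∷ b′ ∷ τ ∷ n ∷ o ∷ []))
  Coord-injective {u} {e} {a} {b} {a′} {b′} _ _ (upper s d) (upper s′ d′)
    = a≡a′ , +-cancelʳ-≡ e b b′ (trans d (trans (cong (_+ n) a≡a′) (sym d′)))
    where
    a≡a′ : a ≡ a′
    a≡a′ = *-cancelˡ-≡ a a′ 2 (cancel-by (cong₂ _+_ (cong₂ _+_ (sym s) s′) (cong₂ _+_ (sym d) d′))
                                  (solve (u ∷ e ∷ a ∷ b ∷ a′ ∷ b′ ∷ τ ∷ n ∷ [])))

toℕ-<⇒≢ : ∀ {n} {i j : Fin n} → toℕ i < toℕ j → i ≢ j
toℕ-<⇒≢ i<j refl = n≮n _ i<j

-- The correspondence between vertices and cells.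

module Coordinates {n τ : ℕ} (3≤n : 3 ≤ n) (τ≤1 : τ ≤ 1) where

  private
    G = C n 3≤n

  record At (A : Subset n) (c : ℕ × ℕ) : Set where
    constructor at
    field
      {i j} : Fin n
      i<j   : toℕ i < toℕ j
      A≡    : A ≡ pair i j
      u<n   : proj₁ c < n
      coord : Coord n τ (toℕ i) (toℕ j) (proj₁ c) (proj₂ c)

  -- Splitting at `n + τ` puts `u` in the range below `n` on both sides. The subtraction of `τ` is
  -- exact since `τ ≤ 1 ≤ b`.
  coord-exists : ∀ {a b} → a < b → b < n → ∃[ u ] ∃[ e ] u < n × Coord n τ a b u e
  coord-exists {a} {b} a<b b<n with a + b <? n + τ
  ... | yes a+b<n+τ = a + b ∸ τ , b ∸ a , +-cancelʳ-< τ _ n (subst (_< n + τ) (sym u-eq) a+b<n+τ)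
                    , lower u-eq (m+[n∸m]≡n (<⇒≤ a<b))
    where
    u-eq : a + b ∸ τ + τ ≡ a + b
    u-eq = m∸n+n≡m (≤-trans τ≤1 (≤-trans (≤-trans z<s a<b) (m≤n+m b a)))
  ... | no a+b≮n+τ = a + b ∸ (n + τ) , a + n ∸ b , u<n
                   , upper (trans +-rearrange u-eq) (m+[n∸m]≡n (≤-trans (<⇒≤ b<n) (m≤n+m n a)))
    where
    u = a + b ∸ (n + τ)
    u-eq : u + (n + τ) ≡ a + b
    u-eq = m∸n+n≡m (≮⇒≥ a+b≮n+τ)
    +-rearrange : u + τ + n ≡ u + (n + τ)
    +-rearrange = trans (+-assoc u τ n) (cong (u +_) (+-comm τ n))
    u<n : u < n
    u<n = +-cancelʳ-< n u n (≤-<-trans (+-monoʳ-≤ u (m≤m+n n τ))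
            (subst (_< n + n) (sym u-eq) (+-mono-< (<-trans a<b b<n) b<n)))

  locate : ∀ {u e y} → u < n → 0 < e → e < n → u + τ + e ≡ y + y →
           Σ[ A ∈ TwoSubset n ] At (proj₁ A) (u , e)
  -- Half of `u + τ + e` is the larger token if `e ≤ y`, and the smaller token otherwise.
  locate {u} {e} {y} u<n 0<e e<n eq = [ low , high ]′ (≤-<-connex e y)
    where
    vertex : ∀ {a b} → a < b → b < n → Coord n τ a b u e → Σ[ A ∈ TwoSubset n ] At (proj₁ A) (u , e)
    vertex a<b b<n coord = (pair i j , ∣pair∣≡2 (toℕ-<⇒≢ i<j)) , at i<j refl u<n
      (subst₂ (λ a b → Coord n τ a b u e) (sym (Fin.toℕ-fromℕ< a<n)) (sym (Fin.toℕ-fromℕ< b<n)) coord)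
      where
      a<n = <-trans a<b b<n
      i = fromℕ< a<n
      j = fromℕ< b<n

      i<j : toℕ i < toℕ j
      i<j = subst₂ _<_ (sym (Fin.toℕ-fromℕ< a<n)) (sym (Fin.toℕ-fromℕ< b<n)) a<b

    -- `u + τ ≤ n` and `e < n` give `y + y < n + n`.
    y<n : y < n
    y<n = ≰⇒> λ n≤y → <-irrefl eq (<-≤-trans
      (+-mono-≤-< (≤-trans (+-monoʳ-≤ u τ≤1) (subst (_≤ n) (+-comm 1 u) u<n)) e<n) (+-mono-≤ n≤y n≤y))

    low : e ≤ y → Σ[ A ∈ TwoSubset n ] At (proj₁ A) (u , e)
    low e≤y = vertex (∸-monoʳ-< 0<e e≤y) y<n (lower-coord eq a-eq)
      where
      a-eq : y ∸ e + e ≡ y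
      a-eq = m∸n+n≡m e≤y

    high : y < e → Σ[ A ∈ TwoSubset n ] At (proj₁ A) (u , e)
    high y<e = vertex y<b b<n (upper-coord eq b-eq)
      where
      b = y + n ∸ e

      b-eq : b + e ≡ y + n
      b-eq = m∸n+n≡m (≤-trans (<⇒≤ e<n) (m≤n+m n y))

      b<n : b < n
      b<n = +-cancelʳ-< e b n (subst₂ _<_ (sym b-eq) (+-comm e n) (+-monoˡ-< n y<e))

      y<b : y < b
      y<b = +-cancelʳ-< e y b (subst (y + e <_) (sym b-eq) (+-monoʳ-< y e<n))

  at-exists : (A : TwoSubset n) → ∃[ c ] At (proj₁ A) c
  at-exists (A , ∣A∣≡2) with i , j , i<j , A≡ ← ∣p∣≡2⇒pair A ∣A∣≡2
    with u , e , u<n , coord ← coord-exists i<j (Fin.toℕ<n j) = (u , e) , at i<j A≡ u<n coord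

  pair-injective : ∀ {i j k l : Fin n} → toℕ i < toℕ j → toℕ k < toℕ l →
                   pair i j ≡ pair k l → i ≡ k × j ≡ l
  pair-injective {i} {j} {k} {l} i<j k<l eq
    with samePair (i∈ (inj₁ refl)) (i∈ (inj₂ refl)) (toℕ-<⇒≢ i<j)
    where
    i∈ : ∀ {x} → x ≡ i ⊎ x ≡ j → x ≡ k ⊎ x ≡ l
    i∈ = x∈pair⁻ k l ∘ subst (_ Subset.∈_) eq ∘ x∈pair⁺ i j
  ... | inj₁ (refl , refl) = refl , refl
  ... | inj₂ (refl , refl) = contradiction i<j (<-asym k<l)

  at-unique : ∀ {A c d} → At A c → At A d → c ≡ d
  at-unique (at i<j refl u<n coord) (at k<l eq v<n coord′)
    with refl , refl ← pair-injective i<j k<l eq = Coord-unique u<n v<n coord coord′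

  at-injective : ∀ {A B c} → At A c → At B c → A ≡ B
  at-injective (at {i} {j} _ refl _ coord) (at {k} {l} _ refl _ coord′)
    with eq , eq′ ← Coord-injective (Fin.toℕ<n j) (Fin.toℕ<n l) coord coord′
    = cong₂ pair (Fin.toℕ-injective eq) (Fin.toℕ-injective eq′)

  -- A token advancing by one cannot pass the other token, so the order of the two is kept. Only a
  -- token moving from n - 1 to 0 changes from larger to smaller.
  move-step : ∀ {i j k l p q w : Fin n} {u e v f} → toℕ i < toℕ j → toℕ k < toℕ l → u < n → v < n →
              Coord n τ (toℕ i) (toℕ j) u e → Coord n τ (toℕ k) (toℕ l) v f →
              Next p q → SamePair i j p w → SamePair k l q w → Step n (u , e) (v , f)
  move-step _ _ u<n v<n c d (inj₁ eq) (inj₁ (refl , refl)) (inj₁ (refl , refl)) =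
    step-lower u<n v<n c (subst (λ x → Coord _ _ x _ _ _) (sym eq) d)
  move-step i<j k<l _ _ _ _ (inj₁ eq) (inj₁ (refl , refl)) (inj₂ (refl , refl)) =
    contradiction (subst (_ <_) (sym eq) k<l) (≤⇒≯ i<j)
  move-step i<j k<l _ _ _ _ (inj₁ eq) (inj₂ (refl , refl)) (inj₁ (refl , refl)) =
    contradiction (<-trans (n<1+n _) (subst (_< _) (sym eq) k<l)) (<-asym i<j)
  move-step _ _ u<n v<n c d (inj₁ eq) (inj₂ (refl , refl)) (inj₂ (refl , refl)) =
    step-higher u<n v<n c (subst (λ x → Coord _ _ _ x _ _) (sym eq) d)
  move-step {j = j} i<j _ _ _ _ _ (inj₂ (eq , _)) (inj₁ (refl , refl)) _ =
    contradiction (Fin.toℕ<n j) (≤⇒≯ (subst (_≤ toℕ j) eq i<j))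
  move-step _ _ u<n _ c d (inj₂ (eq , eq₀)) (inj₂ (refl , refl)) (inj₁ (refl , refl)) =
    step-around eq u<n (Fin.toℕ<n _) c (subst (λ x → Coord _ _ x _ _ _) eq₀ d)
  move-step _ k<l _ _ _ _ (inj₂ (_ , eq₀)) _ (inj₂ (refl , refl)) =
    contradiction (subst (_ <_) eq₀ k<l) n≮0

  at-adjacent : ∀ A B {c d} → Graph._∼_ (F₂ G) A B → At (proj₁ A) c → At (proj₁ B) d →
                Step n c d ⊎ Step n d c
  at-adjacent _ _ (u , v , u∼v , eq) (at i<j refl u<n coord) (at k<l refl v<n coord′)
    with edge-move (toℕ-<⇒≢ i<j) (toℕ-<⇒≢ k<l) (λ u≡v → Graph.∼-irrefl G u≡v u∼v) eq | u∼v
  ... | inj₁ (w , s , t) | inj₁ uv = inj₁ (move-step i<j k<l u<n v<n coord coord′ uv s t)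
  ... | inj₁ (w , s , t) | inj₂ vu = inj₂ (move-step k<l i<j v<n u<n coord′ coord vu t s)
  ... | inj₂ (w , s , t) | inj₁ uv = inj₂ (move-step k<l i<j v<n u<n coord′ coord uv s t)
  ... | inj₂ (w , s , t) | inj₂ vu = inj₁ (move-step i<j k<l u<n v<n coord coord′ vu t s)

  -- From codes on the strip to packings.

  -- Up to reversal, the hypotheses cover every orientation pattern of a walk of length one or two:
  -- one step, two consecutive steps, two steps out of the middle cell, and two steps into it.
  module Packing (Code : ℕ × ℕ → Set)
    (apart     : ∀ {c d}   → Code c → Code d → ¬ Step n c d)
    (apart²    : ∀ {c m d} → Code c → Code d → Step n c m → ¬ Step n m d)
    (same-from : ∀ {c m d} → Code c → Code d → Step n m c → Step n m d → c ≡ d)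
    (same-to   : ∀ {c m d} → Code c → Code d → Step n c m → Step n d m → c ≡ d)
    where

    Located : ℕ × ℕ → Set
    Located c = Σ[ A ∈ TwoSubset n ] At (proj₁ A) c × Code c

    vertices : ∀ {cs} → All Located cs → List (TwoSubset n)
    vertices = All.reduce proj₁

    private
      TwoSubset-≡ : ∀ (A B : TwoSubset n) → proj₁ A ≡ proj₁ B → A ≡ B
      TwoSubset-≡ (A , p) (_ , q) refl = cong (A ,_) (≡-irrelevant p q)

      ∈-vertices : ∀ {cs} (ls : All Located cs) {A} → A ∈ vertices ls →
                   ∃[ c ] c ∈ cs × At (proj₁ A) c × Code c
      ∈-vertices (l All.∷ _)  (here refl) = _ , here refl , proj₂ l
      ∈-vertices (_ All.∷ ls) (there A∈) with c , c∈ , l ← ∈-vertices ls A∈ = c , there c∈ , l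

      unique : ∀ {cs} → Unique cs → (ls : All Located cs) → Unique (vertices ls)
      unique AllPairs.[] All.[] = AllPairs.[]
      unique (c∉ AllPairs.∷ us) ((A , at-c , _) All.∷ ls) = All.tabulate A≢ AllPairs.∷ unique us ls
        where
        A≢ : ∀ {B} → B ∈ vertices ls → A ≢ B
        A≢ B∈ refl with _ , d∈ , at-d , _ ← ∈-vertices ls B∈ = All.lookup c∉ d∈ (at-unique at-c at-d)

      no-short-walk : ∀ {A B c d} → A ≢ B → At (proj₁ A) c → Code c → At (proj₁ B) d → Code d →
                      ∀ {k} → Walk (F₂ G) A B k → 3 ≤ k
      no-short-walk A≢B _ _ _ _ Walk.[] = contradiction refl A≢B
      no-short-walk {A} {B} A≢B at-c code-c at-d code-d (e Walk.∷ Walk.[]) with at-adjacent A B e at-c at-d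
      ... | inj₁ s = contradiction s (apart code-c code-d)
      ... | inj₂ s = contradiction s (apart code-d code-c)
      no-short-walk {A} {B} A≢B at-c code-c at-d code-d (Walk._∷_ {y = M} e (e′ Walk.∷ Walk.[]))
        with m , at-m ← at-exists M with at-adjacent A M e at-c at-m | at-adjacent M B e′ at-m at-d
      ... | inj₁ s | inj₁ t = contradiction t (apart² code-c code-d s)
      ... | inj₂ s | inj₂ t = contradiction s (apart² code-d code-c t)
      ... | inj₁ s | inj₂ t with refl ← same-to code-c code-d s t =
        contradiction (TwoSubset-≡ A B (at-injective at-c at-d)) A≢B
      ... | inj₂ s | inj₁ t with refl ← same-from code-c code-d s t =
        contradiction (TwoSubset-≡ A B (at-injective at-c at-d)) A≢B
      no-short-walk _ _ _ _ _ (_ Walk.∷ (_ Walk.∷ (_ Walk.∷ _))) = s≤s (s≤s (s≤s z≤n))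

      length-vertices : ∀ {cs} (ls : All Located cs) → length (vertices ls) ≡ length cs
      length-vertices All.[]       = refl
      length-vertices (_ All.∷ ls) = cong suc (length-vertices ls)

    packing : ∀ {cs} → Unique cs → All Located cs → PackingOfSize (F₂ G) (length cs)
    packing us ls = vertices ls , unique us ls , far , length-vertices ls
      where
      far : IsPacking (F₂ G) (vertices ls)
      far A B A∈ B∈ A≢B k (walk , _)
        with _ , _ , at-c , code-c ← ∈-vertices ls A∈ | _ , _ , at-d , code-d ← ∈-vertices ls B∈
        = no-short-walk A≢B at-c code-c at-d code-d walk

-- Separation of the code cells.

-- Refutes conflicts between code cells: their congruences are combined into two multiples of 5 that
-- differ by a constant `s`. For a literal `s` the non-divisibility is settled by evaluation.
∤-offset : ∀ s {x y} {_ : False (5 ∣? s)} → 5 ∣ x → 5 ∣ y → s + x ≡ y → ⊥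
∤-offset s {x} {_} {nd} 5∣x 5∣y eq =
  toWitnessFalse nd (∣m+n∣m⇒∣n (subst (5 ∣_) (trans (sym eq) (+-comm s x)) 5∣y) 5∣x)

-- Taking `⊥` for `Layered` gives the plain code and `⊤` the layered one, so a single separation
-- proof serves both. The hypothesis on `n` covers the residues 0 and 2 modulo 10.
module Separation {n : ℕ} (3≤n : 3 ≤ n) (Layered : Set)
  (layered⇒ : Layered → 10 ≤ n × (5 ∣ n ⊎ 5 ∣ 3 + n)) where

  -- The code consists of the cells with 5 ∣ u + w + n + 4.  In the layered code, rows 1
  -- to 3 carry the mirror lattice 5 ∣ u + 3e + n, whose row 3 is moved to row 1.  Only
  -- row₁′ may contain a cell of column 0.
  data Weight (u : ℕ) : ℕ → ℕ → Set where
    bulk  : ∀ {e} → 0 < u → (Layered → 4 ≤ e) → Weight u e (e + e)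
    row₁  : Layered → 0 < u → Weight u 1 0
    row₁′ : Layered → Weight u 1 4
    row₂  : Layered → 0 < u → Weight u 2 2

  record Code (c : ℕ × ℕ) : Set where
    constructor code
    field
      u<n    : proj₁ c < n
      e<n    : proj₂ c < n
      {w}    : ℕ
      weight : Weight (proj₁ c) (proj₂ c) w
      5∣     : 5 ∣ proj₁ c + w + (n + 4)

  private
    low-row : ∀ {e} {A : Set} → (Layered → 4 ≤ e) → Layered → {_ : False (4 ≤? e)} → A
    low-row h l {nd} = contradiction (h l) (toWitnessFalse nd)

  -- Away from the seam, two cells joined by at most two steps lie at most two rows apart. The
  -- congruence sees only `u + w`, so the few possible weight differences for each row distance
  -- decide every such conflict.
  same-row : ∀ {u v e w x} → Weight u e w → Weight v e x → x ≡ w ⊎ x ≡ 4 + w ⊎ w ≡ 4 + x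
  same-row (bulk _ _)  (bulk _ _)  = inj₁ refl
  same-row (bulk _ h)  (row₁ l _)  = low-row h l
  same-row (bulk _ h)  (row₁′ l)   = low-row h l
  same-row (bulk _ h)  (row₂ l _)  = low-row h l
  same-row (row₁ l _)  (bulk _ h)  = low-row h l
  same-row (row₁ _ _)  (row₁ _ _)  = inj₁ refl
  same-row (row₁ _ _)  (row₁′ _)   = inj₂ (inj₁ refl)
  same-row (row₁′ l)   (bulk _ h)  = low-row h l
  same-row (row₁′ _)   (row₁ _ _)  = inj₂ (inj₂ refl)
  same-row (row₁′ _)   (row₁′ _)   = inj₁ refl
  same-row (row₂ l _)  (bulk _ h)  = low-row h l
  same-row (row₂ _ _)  (row₂ _ _)  = inj₁ refl

  next-row : ∀ {u v e w x} → Weight u e w → Weight v (1 + e) x → x ≡ 2 + w ⊎ w ≡ 2 + x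
  next-row (bulk {e} _ _) (bulk _ _) = inj₁ (cong suc (+-suc e e))
  next-row (bulk _ h) (row₁ l _) = low-row h l
  next-row (bulk _ h) (row₁′ l)  = low-row h l
  next-row (bulk _ h) (row₂ l _) = low-row h l
  next-row (row₁ l _) (bulk _ h) = low-row h l
  next-row (row₁ _ _) (row₂ _ _) = inj₁ refl
  next-row (row₁′ l)  (bulk _ h) = low-row h l
  next-row (row₁′ _)  (row₂ _ _) = inj₂ refl
  next-row (row₂ l _) (bulk _ h) = low-row h l

  second-row : ∀ {u v e w x} → Weight u e w → Weight v (2 + e) x → x ≡ 4 + w ⊎ x ≡ 6 + w
  second-row (bulk {e} _ _) (bulk _ _) = inj₁ (solve (e ∷ []))
  second-row (bulk _ h) (row₂ l _) = low-row h l
  second-row (row₁ l _) (bulk _ h) = low-row h l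
  second-row (row₁′ l)  (bulk _ h) = low-row h l
  second-row (row₂ _ _) (bulk _ _) = inj₂ refl

  -- All other constructors demand a positive column. Hence `(0 , 1)` is the only possible code cell
  -- of column 0.
  first-column : ∀ {e w} → Weight 0 e w → Layered × e ≡ 1 × w ≡ 4
  first-column (row₁′ l) = l , refl , refl

  private
    too-large : ∀ {m} {A : Set} → Layered → {_ : False (10 ≤? m)} → m ≡ n → A
    too-large l {nd} refl = contradiction (proj₁ (layered⇒ l)) (toWitnessFalse nd)

  corner₁ : ∀ {u e} → suc u ≡ n → 2 + e ≡ n → Code (u , e) → ¬ Code (0 , 1)
  corner₁ {e = e} refl refl (code _ _ wt 5∣x) (code _ _ wt′ 5∣y) = case first-column wt′ of λ where
    (l , _ , refl) → case wt of λ where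
      -- In terms of `e` the two multiples of 5 are `4 * e + 7` and `e + 10`; four times the second
      -- exceeds the first by 33. The constants in `corner₂` arise in the same way.
      (bulk _ _) → ∤-offset 33 5∣x (∣n⇒∣m*n 4 5∣y) (solve (e ∷ []))
      (row₁ _ _) → too-large l refl
      (row₁′ _)  → too-large l refl
      (row₂ _ _) → too-large l refl

  corner₂ : ∀ {u e} → 2 + u ≡ n → 1 + e ≡ n ⊎ 3 + e ≡ n → Code (u , e) → ¬ Code (0 , 1)
  corner₂ {u} refl (inj₁ refl) (code _ _ wt 5∣x) (code _ _ wt′ 5∣y) = case first-column wt′ of λ where
    (l , _ , refl) → case wt of λ where
      (bulk _ _) → ∤-offset 32 5∣x (∣n⇒∣m*n 4 5∣y) (solve (u ∷ []))
      (row₁ _ _) → too-large l refl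
      (row₂ _ _) → too-large l refl
      (row₁′ _)  → too-large l refl
  corner₂ {e = e} refl (inj₂ refl) (code _ _ wt 5∣x) (code _ _ wt′ 5∣y) = case first-column wt′ of λ where
    (l , _ , refl) → case wt of λ where
      (bulk _ _) → ∤-offset 36 5∣x (∣n⇒∣m*n 4 5∣y) (solve (e ∷ []))
      (row₁ _ _) → too-large l refl
      (row₁′ _)  → too-large l refl
      (row₂ _ _) → too-large l refl

  -- These are the pairs two steps apart across the seam. As gluing reverses the rows, the
  -- congruences are added instead of subtracted: two bulk cells give `5 * n` plus 8, 12 or 4, never
  -- a multiple of 5.
  seam : ∀ {u e f} → suc u ≡ n → e + f ≡ n ⊎ e + f ≡ 2 + n ⊎ 2 + (e + f) ≡ n →
         Code (u , e) → ¬ Code (1 , f)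
  seam {u} {e} {f} last sum (code _ e<n wt 5∣x) (code _ f<n wt′ 5∣y) = go wt wt′ 5∣x 5∣y sum
    where
    5∣5n : 5 ∣ 5 * n
    5∣5n = m∣m*n n

    go : ∀ {w x} → Weight u e w → Weight 1 f x → 5 ∣ u + w + (n + 4) → 5 ∣ 1 + x + (n + 4) →
         e + f ≡ n ⊎ e + f ≡ 2 + n ⊎ 2 + (e + f) ≡ n → ⊥
    go (bulk _ _) (bulk _ _) 5∣x 5∣y (inj₁ eq) =
      ∤-offset 8 5∣5n (∣m∣n⇒∣m+n 5∣x 5∣y)
        (cancel-by (cong₂ _+_ (sym last) (cong₂ _+_ (sym eq) (sym eq))) (solve (u ∷ e ∷ f ∷ n ∷ [])))
    go (bulk _ _) (bulk _ _) 5∣x 5∣y (inj₂ (inj₁ eq)) =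
      ∤-offset 12 5∣5n (∣m∣n⇒∣m+n 5∣x 5∣y)
        (cancel-by (cong₂ _+_ (sym last) (cong₂ _+_ (sym eq) (sym eq))) (solve (u ∷ e ∷ f ∷ n ∷ [])))
    go (bulk _ _) (bulk _ _) 5∣x 5∣y (inj₂ (inj₂ eq)) =
      ∤-offset 4 5∣5n (∣m∣n⇒∣m+n 5∣x 5∣y)
        (cancel-by (cong₂ _+_ (sym last) (cong₂ _+_ (sym eq) (sym eq))) (solve (u ∷ e ∷ f ∷ n ∷ [])))
    go (bulk _ _) (row₁ _ _) 5∣x 5∣y (inj₁ eq) =
      ∤-offset 6 5∣5n (∣m∣n⇒∣m+n 5∣x 5∣y)
        (cancel-by (cong₂ _+_ (sym last) (cong₂ _+_ (sym eq) (sym eq))) (solve (u ∷ e ∷ n ∷ [])))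
    -- A weight two below the bulk value turns the offset 12 into 10, so divisibility gives no
    -- contradiction. Here the bulk cell would lie outside the strip; the same happens below with
    -- `row₂`.
    go (bulk _ _) (row₁ _ _) 5∣x 5∣y (inj₂ (inj₁ eq)) =
      with-slack e<n λ o o-eq → absurd {x = 1 + o} (cong₂ _+_ (sym eq) o-eq) (solve (e ∷ n ∷ o ∷ []))
    go (bulk _ _) (row₁ _ _) 5∣x 5∣y (inj₂ (inj₂ eq)) =
      ∤-offset 2 5∣5n (∣m∣n⇒∣m+n 5∣x 5∣y)
        (cancel-by (cong₂ _+_ (sym last) (cong₂ _+_ (sym eq) (sym eq))) (solve (u ∷ e ∷ n ∷ [])))
    -- The residue of `n` keeps this strand out of column 1 altogether.
    go _ (row₁′ l) _ 5∣y _ = case proj₂ (layered⇒ l) of λ where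
      (inj₁ 5∣n)   → ∤-offset 9 5∣n 5∣y (solve (n ∷ []))
      (inj₂ 5∣3+n) → ∤-offset 6 5∣3+n 5∣y (solve (n ∷ []))
    go (bulk _ _) (row₂ _ _) 5∣x 5∣y (inj₁ eq) =
      ∤-offset 6 5∣5n (∣m∣n⇒∣m+n 5∣x 5∣y)
        (cancel-by (cong₂ _+_ (sym last) (cong₂ _+_ (sym eq) (sym eq))) (solve (u ∷ e ∷ n ∷ [])))
    go (bulk _ _) (row₂ _ _) 5∣x 5∣y (inj₂ (inj₁ eq)) =
      <-irrefl (+-cancelʳ-≡ 2 e n (trans eq (+-comm 2 n))) e<n
    go (bulk _ _) (row₂ _ _) 5∣x 5∣y (inj₂ (inj₂ eq)) =
      ∤-offset 2 5∣5n (∣m∣n⇒∣m+n 5∣x 5∣y)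
        (cancel-by (cong₂ _+_ (sym last) (cong₂ _+_ (sym eq) (sym eq))) (solve (u ∷ e ∷ n ∷ [])))
    -- The residue of `n` also keeps both strands of row 1 out of the last column.
    go (row₁ l _) _ 5∣x _ _ = case proj₂ (layered⇒ l) of λ where
      (inj₁ 5∣n)   → ∤-offset 3 (∣n⇒∣m*n 2 5∣n) 5∣x (cancel-by (sym last) (solve (u ∷ n ∷ [])))
      (inj₂ 5∣3+n) → ∤-offset 3 5∣x (∣n⇒∣m*n 2 5∣3+n) (cancel-by last (solve (u ∷ n ∷ [])))
    go (row₁′ l) _ 5∣x _ _ = case proj₂ (layered⇒ l) of λ where
      (inj₁ 5∣n)   → ∤-offset 7 (∣n⇒∣m*n 2 5∣n) 5∣x (cancel-by (sym last) (solve (u ∷ n ∷ [])))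
      (inj₂ 5∣3+n) → ∤-offset 1 (∣n⇒∣m*n 2 5∣3+n) 5∣x (cancel-by (sym last) (solve (u ∷ n ∷ [])))
    go (row₂ _ _) (bulk _ _) 5∣x 5∣y (inj₁ eq) =
      ∤-offset 6 5∣5n (∣m∣n⇒∣m+n 5∣x 5∣y)
        (cancel-by (cong₂ _+_ (sym last) (cong₂ _+_ (sym eq) (sym eq))) (solve (u ∷ f ∷ n ∷ [])))
    go (row₂ _ _) (bulk _ _) 5∣x 5∣y (inj₂ (inj₁ eq)) = <-irrefl (+-cancelˡ-≡ 2 f n eq) f<n
    go (row₂ _ _) (bulk _ _) 5∣x 5∣y (inj₂ (inj₂ eq)) =
      ∤-offset 2 5∣5n (∣m∣n⇒∣m+n 5∣x 5∣y)
        (cancel-by (cong₂ _+_ (sym last) (cong₂ _+_ (sym eq) (sym eq))) (solve (u ∷ f ∷ n ∷ [])))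
    -- Two cells this close to the boundary meet across the seam only when `n` is at most 6.
    go (row₂ l _) (row₁ _ _) _ _ (inj₁ eq) = too-large l eq
    go (row₂ l _) (row₁ _ _) _ _ (inj₂ (inj₁ refl)) = too-large l refl
    go (row₂ l _) (row₁ _ _) _ _ (inj₂ (inj₂ eq)) = too-large l eq
    go (row₂ l _) (row₂ _ _) _ _ (inj₁ eq) = too-large l eq
    go (row₂ l _) (row₂ _ _) _ _ (inj₂ (inj₁ eq)) = too-large l (suc-injective (suc-injective eq))
    go (row₂ l _) (row₂ _ _) _ _ (inj₂ (inj₂ eq)) = too-large l eq

  two-rows-apart : ∀ {u v e} s {_ : False (5 ∣? 4 + s)} {_ : False (5 ∣? 6 + s)} →
                   v ≡ s + u → Code (u , e) → ¬ Code (v , 2 + e)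
  two-rows-apart {u} s {d₄} {d₆} refl (code _ _ {w} wt 5∣x) (code _ _ wt′ 5∣y) =
    case second-row wt wt′ of λ where
      (inj₁ refl) → ∤-offset (4 + s) {_} {_} {d₄} 5∣x 5∣y (solve (s ∷ u ∷ w ∷ n ∷ []))
      (inj₂ refl) → ∤-offset (6 + s) {_} {_} {d₆} 5∣x 5∣y (solve (s ∷ u ∷ w ∷ n ∷ []))

  apart : ∀ {c d} → Code c → Code d → ¬ Step n c d
  apart {u , _} (code _ _ {w} wt 5∣x) (code _ _ {x} wt′ 5∣y) up = case next-row wt wt′ of λ where
    (inj₁ refl) → ∤-offset 3 5∣x 5∣y (solve (u ∷ w ∷ n ∷ []))
    (inj₂ refl) → ∤-offset 1 5∣y 5∣x (solve (u ∷ x ∷ n ∷ []))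
  apart {u , _} (code _ _ {w} wt 5∣x) (code _ _ {x} wt′ 5∣y) down = case next-row wt′ wt of λ where
    (inj₁ refl) → ∤-offset 1 5∣y 5∣x (solve (u ∷ x ∷ n ∷ []))
    (inj₂ refl) → ∤-offset 3 5∣x 5∣y (solve (u ∷ w ∷ n ∷ []))
  apart {_ , e} c d (wrap⁺ _ eq) with _ , refl , _ ← first-column (Code.weight d) =
    <-irrefl (+-cancelʳ-≡ 1 e n (trans eq (+-comm 1 n))) (Code.e<n c)
  apart {_ , e} c d (wrap⁻ last eq) with _ , refl , _ ← first-column (Code.weight d) =
    corner₁ last (trans (cong suc (+-comm 1 e)) eq) c d

  same-row-apart : ∀ {u e} → Code (u , e) → ¬ Code (2 + u , e)
  same-row-apart {u} (code _ _ {w} wt 5∣x) (code _ _ {x} wt′ 5∣y) = case same-row wt wt′ of λ where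
    (inj₁ refl)        → ∤-offset 2 5∣x 5∣y (solve (u ∷ w ∷ n ∷ []))
    (inj₂ (inj₁ refl)) → ∤-offset 6 5∣x 5∣y (solve (u ∷ w ∷ n ∷ []))
    (inj₂ (inj₂ refl)) → ∤-offset 2 5∣y 5∣x (solve (u ∷ x ∷ n ∷ []))

  descending-apart : ∀ {u e} → Code (u , 2 + e) → ¬ Code (2 + u , e)
  descending-apart {u} (code _ _ {w} wt 5∣x) (code _ _ {x} wt′ 5∣y) = case second-row wt′ wt of λ where
    (inj₁ refl) → ∤-offset 2 5∣y 5∣x (solve (u ∷ x ∷ n ∷ []))
    (inj₂ refl) → ∤-offset 4 5∣y 5∣x (solve (u ∷ x ∷ n ∷ []))

  apart² : ∀ {c m d} → Code c → Code d → Step n c m → ¬ Step n m d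
  apart² c d up   up   = two-rows-apart 2 refl c d
  apart² c d up   down = same-row-apart c d
  apart² c d down up   = same-row-apart c d
  apart² c d down down = descending-apart c d
  -- The target is `(0 , 1)`, so the middle cell would be in row `n`, which `Step` does not exclude.
  apart² {_ , e} c d s (wrap⁺ last eq) with _ , refl , _ ← first-column (Code.weight d) | s
  ... | up   = corner₂ last (inj₁ (+-cancelʳ-≡ 1 (1 + e) n (trans eq (+-comm 1 n)))) c d
  ... | down {e = g} = <-asym (Code.e<n c) (subst (_< suc g) (+-cancelʳ-≡ 1 g n (trans eq (+-comm 1 n))) ≤-refl)
  ... | wrap⁺ _ _ = contradiction (subst (3 ≤_) (sym last) 3≤n) λ { (s≤s ()) }
  ... | wrap⁻ _ _ = contradiction (subst (3 ≤_) (sym last) 3≤n) λ { (s≤s ()) }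
  apart² {_ , e} c d s (wrap⁻ last eq) with _ , refl , _ ← first-column (Code.weight d) | s
  ... | up   = corner₂ last (inj₂ (trans (cong (2 +_) (+-comm 1 e)) eq)) c d
  ... | down {e = g} = corner₂ last (inj₁ (trans (cong suc (+-comm 1 g)) eq)) c d
  ... | wrap⁺ _ _ = contradiction (subst (3 ≤_) (sym last) 3≤n) λ { (s≤s ()) }
  ... | wrap⁻ _ _ = contradiction (subst (3 ≤_) (sym last) 3≤n) λ { (s≤s ()) }
  apart² {_ , e} c d (wrap⁺ {f = g} last eq) up =
    seam last (inj₂ (inj₁ (trans (+-suc e g) (cong suc eq)))) c d
  apart² {_ , e} c d (wrap⁺ {f = suc g} last eq) down =
    seam last (inj₁ (suc-injective (trans (sym (+-suc e g)) eq))) c d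
  apart² {_ , e} c d (wrap⁻ {f = g} last eq) up =
    seam last (inj₁ (trans (+-suc e g) eq)) c d
  apart² {_ , e} c d (wrap⁻ {f = suc g} last eq) down =
    seam last (inj₂ (inj₂ (trans (cong suc (sym (+-suc e g))) eq))) c d

  same-from : ∀ {c m d} → Code c → Code d → Step n m c → Step n m d → c ≡ d
  same-from c d up up = refl
  same-from c d up down = contradiction c (two-rows-apart 0 refl d)
  same-from c d down up = contradiction d (two-rows-apart 0 refl c)
  same-from c d down down = refl
  same-from c d up   (wrap⁺ last _) = contradiction (Code.u<n c) (<-irrefl last)
  same-from c d up   (wrap⁻ last _) = contradiction (Code.u<n c) (<-irrefl last)
  same-from c d down (wrap⁺ last _) = contradiction (Code.u<n c) (<-irrefl last)
  same-from c d down (wrap⁻ last _) = contradiction (Code.u<n c) (<-irrefl last)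
  same-from c d (wrap⁺ last _) up   = contradiction (Code.u<n d) (<-irrefl last)
  same-from c d (wrap⁺ last _) down = contradiction (Code.u<n d) (<-irrefl last)
  same-from c d (wrap⁻ last _) up   = contradiction (Code.u<n d) (<-irrefl last)
  same-from c d (wrap⁻ last _) down = contradiction (Code.u<n d) (<-irrefl last)
  -- Both steps wrap, and column 0 has only one possible code cell.
  same-from {0 , _} {_} {0 , _} c d _ _
    with _ , refl , _ ← first-column (Code.weight c) | _ , refl , _ ← first-column (Code.weight d) = refl

  same-to : ∀ {c m d} → Code c → Code d → Step n c m → Step n d m → c ≡ d
  same-to c d up up = refl
  same-to c d up down = contradiction d (two-rows-apart 0 refl c)
  same-to c d down up = contradiction c (two-rows-apart 0 refl d)
  same-to c d down down = refl
  same-to {_ , e} {_} {_ , f} c d (wrap⁺ {f = g} refl eq) (wrap⁺ refl eq′) =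
    cong (_ ,_) (+-cancelʳ-≡ g e f (trans eq (sym eq′)))
  same-to {_ , e} {_} {_ , f} c d (wrap⁻ {f = g} refl eq) (wrap⁻ refl eq′) =
    cong (_ ,_) (+-cancelʳ-≡ g e f (suc-injective (trans eq (sym eq′))))
  -- Opposite wraps into one cell start two rows apart in the last column.
  same-to {_ , e} {_} {_ , f} c d (wrap⁺ {f = g} refl eq) (wrap⁻ refl eq′)
    with refl ← +-cancelʳ-≡ g e (2 + f) (trans eq (cong suc (sym eq′))) =
    contradiction c (two-rows-apart 0 refl d)
  same-to {_ , e} {_} {_ , f} c d (wrap⁻ {f = g} refl eq) (wrap⁺ refl eq′)
    with refl ← +-cancelʳ-≡ g f (2 + e) (trans eq′ (cong suc (sym eq))) =
    contradiction d (two-rows-apart 0 refl c)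

-- Enumeration of the code by rows and residues of columns.

-- A key that is constant on each block makes the blocks disjoint. The keys used are the row of a
-- cell and, within a row, its column modulo 10.
concatMap-unique : {A B K : Set} (f : A → List B) (key : A → K) (key′ : B → K) →
                   (∀ x {y} → y ∈ f x → key′ y ≡ key x) → (∀ x → Unique (f x)) →
                   ∀ {xs} → AllPairs (λ x y → key x ≢ key y) xs → Unique (concatMap f xs)
concatMap-unique f key key′ key-≡ unique {xs} keys =
  Unique.concat⁺ (All.map⁺ (All.universal unique xs))
    (AllPairs.map⁺ (AllPairs.map disjoint keys))
  where
  disjoint : ∀ {x y} → key x ≢ key y → Disjoint (f x) (f y)
  disjoint {x} {y} x≢y (z∈fx , z∈fy) = x≢y (trans (sym (key-≡ x z∈fx)) (key-≡ y z∈fy))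

module Strands {n r k τ : ℕ} (n≡ : n ≡ r + k * 10) (3≤n : 3 ≤ n) (τ≤1 : τ ≤ 1) (Layered : Set)
  (layered⇒ : Layered → 10 ≤ n × (5 ∣ n ⊎ 5 ∣ 3 + n)) where

  open Coordinates {n} {τ} 3≤n τ≤1
  open Separation 3≤n Layered layered⇒
  open Packing Code apart apart² same-from same-to

  -- The ceiling of `(n - γ) / 10`, with the `k` full periods split off; this needs `γ ≤ r + 9`
  -- because subtraction is truncated.
  points : ℕ → ℕ
  points γ = (r + 9 ∸ γ) / 10 + k

  strand : ℕ → ℕ → List (ℕ × ℕ)
  strand e γ = applyUpTo (λ j → γ + j * 10 , e) (points γ)

  -- The period 10 of a strand preserves both the congruence modulo 5 and the parity, so they are
  -- required only at its start.
  record Strand (e γ : ℕ) : Set where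
    field
      γ≤r+9  : γ ≤ r + 9
      {w}    : ℕ
      weight : ∀ u → γ ≤ u → Weight u e w
      5∣     : 5 ∣ γ + w + (n + 4)
      2∣     : 2 ∣ γ + τ + e

  points-bound : ∀ {γ j} → γ ≤ r + 9 → j < points γ → γ + j * 10 < n
  points-bound {γ} {j} γ≤ j< = +-cancelʳ-≤ 9 _ _ (begin
    suc (γ + j * 10) + 9          ≡⟨ solve (γ ∷ j ∷ []) ⟩
    γ + suc j * 10                ≤⟨ +-monoʳ-≤ γ (*-monoˡ-≤ 10 j<) ⟩
    γ + (q / 10 + k) * 10         ≡⟨ cong (γ +_) (*-distribʳ-+ 10 (q / 10) k) ⟩
    γ + (q / 10 * 10 + k * 10)    ≤⟨ +-monoʳ-≤ γ (+-monoˡ-≤ (k * 10) (m/n*n≤m q 10)) ⟩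
    γ + (q + k * 10)              ≡⟨ +-assoc γ q (k * 10) ⟨
    γ + q + k * 10                ≡⟨ cong (_+ k * 10) (m+[n∸m]≡n γ≤) ⟩
    r + 9 + k * 10                ≡⟨ solve (r ∷ k ∷ []) ⟩
    r + k * 10 + 9                ≡⟨ cong (_+ 9) n≡ ⟨
    n + 9                         ∎)
    where
    open ≤-Reasoning
    q = r + 9 ∸ γ

  2∣⇒double : ∀ {m} → 2 ∣ m → ∃[ y ] m ≡ y + y
  2∣⇒double (divides y eq) = y , trans eq (trans (*-comm y 2) (cong (y +_) (+-identityʳ y)))

  strand-located : ∀ {e γ} → 0 < e → e < n → Strand e γ → ∀ {c} → c ∈ strand e γ → Located c
  strand-located {e} {γ} 0<e e<n s c∈ with j , j< , refl ← ∈-applyUpTo⁻ _ c∈ =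
    proj₁ vertex , proj₂ vertex ,
    code u<n e<n (weight (γ + j * 10) (m≤m+n γ (j * 10)))
      (subst (5 ∣_) (shift w (n + 4)) (∣m∣n⇒∣m+n 5∣ (∣n⇒∣m*n j (divides 2 refl))))
    where
    open Strand s
    u<n = points-bound γ≤r+9 j<

    shift : ∀ x y → γ + x + y + j * 10 ≡ γ + j * 10 + x + y
    shift x y = solve (γ ∷ x ∷ y ∷ j ∷ [])

    even : 2 ∣ γ + j * 10 + τ + e
    even = subst (2 ∣_) (shift τ e) (∣m∣n⇒∣m+n 2∣ (∣n⇒∣m*n j (divides 5 refl)))

    vertex : Σ[ A ∈ TwoSubset n ] At (proj₁ A) (γ + j * 10 , e)
    vertex = case 2∣⇒double even of λ (y , eq) → locate {y = y} u<n 0<e e<n eq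

  row : (ℕ → List ℕ) → ℕ → List (ℕ × ℕ)
  row starts e = concatMap (strand e) (starts e)

  cells : (ℕ → List ℕ) → List (ℕ × ℕ)
  cells starts = concatMap (row starts) (applyUpTo suc (n ∸ 1))

  module _ (starts : ℕ → List ℕ)
    (strands  : ∀ {e} → 0 < e → e < n → All (Strand e) (starts e))
    (distinct : ∀ e → AllPairs (λ γ γ′ → γ % 10 ≢ γ′ % 10) (starts e)) where

    cells-located : ∀ {c} → c ∈ cells starts → Located c
    cells-located c∈
      with _ , e∈ , c∈row ← find (∈-concatMap⁻ (row starts) {xs = applyUpTo suc (n ∸ 1)} c∈)
      with i , i<n-1 , refl ← ∈-applyUpTo⁻ suc {n = n ∸ 1} e∈
      with _ , γ∈ , c∈strand ← find (∈-concatMap⁻ (strand (suc i)) {xs = starts (suc i)} c∈row)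
      = strand-located z<s e<n (All.lookup (strands z<s e<n) γ∈) c∈strand
      where
      e<n = subst (suc i <_) (m+[n∸m]≡n (≤-trans z<s 3≤n)) (s<s i<n-1)

    cells-unique : Unique (cells starts)
    cells-unique = concatMap-unique (row starts) id proj₂ row-key row-unique
      (AllPairs.applyUpTo⁺₁ suc (n ∸ 1) λ i<j _ → <⇒≢ (s<s i<j))
      where
      strand-key : ∀ e γ {c} → c ∈ strand e γ → proj₁ c % 10 ≡ γ % 10
      strand-key e γ c∈ with j , _ , refl ← ∈-applyUpTo⁻ _ c∈ = [m+kn]%n≡m%n γ j 10

      row-key : ∀ e {c} → c ∈ row starts e → proj₂ c ≡ e
      row-key e c∈ with _ , _ , c∈strand ← find (∈-concatMap⁻ (strand e) {xs = starts e} c∈)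
        with _ , _ , refl ← ∈-applyUpTo⁻ _ c∈strand = refl

      strand-unique : ∀ e γ → Unique (strand e γ)
      strand-unique e γ = Unique.applyUpTo⁺₁ _ (points γ) λ i<j _ eq →
        <⇒≢ i<j (*-cancelʳ-≡ _ _ 10 (+-cancelˡ-≡ γ _ _ (cong proj₁ eq)))

      row-unique : ∀ e → Unique (row starts e)
      row-unique e = concatMap-unique (strand e) (_% 10) ((_% 10) ∘ proj₁)
        (strand-key e) (strand-unique e) (distinct e)

    strands-packing : PackingOfSize (F₂ (C n 3≤n)) (length (cells starts))
    strands-packing = packing cells-unique (All.tabulate cells-located)

-- Counting the cells.

length-concatMap : {A B : Set} (f : A → List B) → ∀ xs →
                   length (concatMap f xs) ≡ sum (map (length ∘ f) xs)
length-concatMap f []       = refl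
length-concatMap f (x ∷ xs) = trans (length-++ (f x)) (cong (length (f x) +_) (length-concatMap f xs))

Σ< : ℕ → (ℕ → ℕ) → ℕ
Σ< m f = sum (applyUpTo f m)

Σ<-cong : ∀ m {f g} → (∀ i → f i ≡ g i) → Σ< m f ≡ Σ< m g
Σ<-cong zero    f≗g = refl
Σ<-cong (suc m) f≗g = cong₂ _+_ (f≗g 0) (Σ<-cong m (f≗g ∘ suc))

Σ<-+-const : ∀ m k f → Σ< m (λ i → f i + k) ≡ m * k + Σ< m f
Σ<-+-const zero    k f = refl
Σ<-+-const (suc m) k f = trans (cong (f 0 + k +_) (Σ<-+-const m k (f ∘ suc)))
                                 (rearrange (f 0) (Σ< m (f ∘ suc)))
  where
  rearrange : ∀ x s → x + k + (m * k + s) ≡ k + m * k + (x + s)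
  rearrange x s = solve (x ∷ s ∷ k ∷ m ∷ [])

Σ<-split : ∀ a b f → Σ< (a + b) f ≡ Σ< a f + Σ< b (λ i → f (a + i))
Σ<-split zero    b f = refl
Σ<-split (suc a) b f = trans (cong (f 0 +_) (Σ<-split a b (f ∘ suc))) (sym (+-assoc (f 0) _ _))

Σ<-periodic : ∀ m k f → (∀ i → f (10 + i) ≡ f i) → Σ< (m + k * 10) f ≡ k * Σ< 10 f + Σ< m f
Σ<-periodic m zero    f per = cong (λ x → Σ< x f) (+-identityʳ m)
Σ<-periodic m (suc k) f per = begin
  Σ< (m + (10 + k * 10)) f                         ≡⟨ cong (λ x → Σ< x f) (reorder m (k * 10)) ⟩
  Σ< (10 + (m + k * 10)) f                         ≡⟨ Σ<-split 10 (m + k * 10) f ⟩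
  Σ< 10 f + Σ< (m + k * 10) (λ i → f (10 + i))     ≡⟨ cong (Σ< 10 f +_) (Σ<-cong (m + k * 10) per) ⟩
  Σ< 10 f + Σ< (m + k * 10) f                      ≡⟨ cong (Σ< 10 f +_) (Σ<-periodic m k f per) ⟩
  Σ< 10 f + (k * Σ< 10 f + Σ< m f)                 ≡⟨ +-assoc (Σ< 10 f) _ _ ⟨
  Σ< 10 f + k * Σ< 10 f + Σ< m f                   ∎
  where
  open ≡-Reasoning
  reorder : ∀ m x → m + (10 + x) ≡ 10 + (m + x)
  reorder m x = solve (m ∷ x ∷ [])

-- The first column u ≥ 1 that has a cell of the lattice 5 ∣ u + 2e + n + 4 in row e,
-- when 5 ∣ ν + n and 2 ∣ 1 + ν + τ.
start-column : ℕ → ℕ → ℕ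
start-column ν e = 1 + (e * 3 + ν) % 10

start-column-periodic : ∀ ν e → start-column ν (10 + e) ≡ start-column ν e
start-column-periodic ν e = cong suc (trans (cong (_% 10) shift) ([m+kn]%n≡m%n (e * 3 + ν) 3 10))
  where
  shift : (10 + e) * 3 + ν ≡ e * 3 + ν + 3 * 10
  shift = solve (e ∷ ν ∷ [])

-- Reduction modulo 10 does not affect divisibility by a divisor of 10; this is applied with 5 and
-- 2.
∣-start-column : ∀ {d} ν e z → d ∣ 10 → d ∣ 1 + (e * 3 + ν) + z → d ∣ start-column ν e + z
∣-start-column {d} ν e z d∣10 d∣ = ∣m+n∣m⇒∣n (subst (d ∣_) split d∣) (∣n⇒∣m*n (m / 10) d∣10)
  where
  m = e * 3 + ν

  rearrange : ∀ t q → 1 + (t + q) + z ≡ q + (1 + t + z)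
  rearrange t q = solve (t ∷ q ∷ z ∷ [])

  split : 1 + m + z ≡ m / 10 * 10 + (start-column ν e + z)
  split = trans (cong (λ x → 1 + x + z) (m≡m%n+[m/n]*n m 10)) (rearrange (m % 10) (m / 10 * 10))

count : ℕ → ℕ → ℕ
count r γ = (r + 9 ∸ γ) / 10

-- The right side counts `k` full periods of columns in each of the `n - 1` rows, then `k` blocks of
-- ten rows in the remaining columns, then a remainder `s`. The first two terms match the growth of
-- `n * (n - 2) / 10` with `k` exactly, which leaves a condition free of `k`.
quotient-bound : ∀ {n} m k s → n ≡ 2 + m + k * 10 → (2 + m) * m / 10 + 1 ≤ s →
        n * (n ∸ 2) / 10 + 1 ≤ (1 + m + k * 10) * k + (k * (1 + m) + s)
quotient-bound m k s refl ≤s = begin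
  (2 + m + k * 10) * (m + k * 10) / 10 + 1              ≡⟨ cong (λ x → x / 10 + 1) expand ⟩
  ((2 + m) * m + q * 10) / 10 + 1                       ≡⟨ cong (_+ 1) (+-distrib-/-∣ʳ ((2 + m) * m) (divides q refl)) ⟩
  (2 + m) * m / 10 + q * 10 / 10 + 1                    ≡⟨ cong (λ x → (2 + m) * m / 10 + x + 1) (m*n/n≡m q 10) ⟩
  (2 + m) * m / 10 + q + 1                              ≡⟨ swap-last ((2 + m) * m / 10) q ⟩
  q + ((2 + m) * m / 10 + 1)                            ≤⟨ +-monoʳ-≤ q ≤s ⟩
  q + s                                                 ≡⟨ +-assoc ((1 + m + k * 10) * k) (k * (1 + m)) s ⟩
  (1 + m + k * 10) * k + (k * (1 + m) + s)              ∎
  where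
  open ≤-Reasoning
  q = (1 + m + k * 10) * k + k * (1 + m)

  expand : (2 + m + k * 10) * (m + k * 10) ≡ (2 + m) * m + ((1 + m + k * 10) * k + k * (1 + m)) * 10
  expand = solve (m ∷ k ∷ [])

  swap-last : ∀ x y → x + y + 1 ≡ y + (x + 1)
  swap-last x y = solve (x ∷ y ∷ [])

packing⇒≤ρ : ∀ {n} (3≤n : 3 ≤ n) {l m} → l ≡ m → PackingOfSize (F₂ (C n 3≤n)) l →
             m ≤ ρ (F₂ (C n 3≤n))
packing⇒≤ρ 3≤n refl = proj₂ (proj₂ (packingNumber (F₂ (C _ 3≤n))))

collect-rows : ∀ k x y z m l s → x + k + (y + k + 0) + (z + k + 0 + (m * k + (l + s))) ≡
                             (3 + m) * k + (l + (x + y + z + s))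
collect-rows k x y z m l s = solve (k ∷ x ∷ y ∷ z ∷ m ∷ l ∷ s ∷ [])

length-rows : {A : Set} (row : ℕ → List A) (size : ℕ → ℕ) → (∀ e → length (row e) ≡ size e) →
              ∀ m → length (concatMap row (applyUpTo suc m)) ≡ Σ< m (size ∘ suc)
length-rows row size eq m = begin
  length (concatMap row (applyUpTo suc m))       ≡⟨ length-concatMap row (applyUpTo suc m) ⟩
  sum (map (length ∘ row) (applyUpTo suc m))     ≡⟨ cong sum (map-applyUpTo suc (length ∘ row) m) ⟩
  Σ< m (length ∘ row ∘ suc)                      ≡⟨ Σ<-cong m (eq ∘ suc) ⟩
  Σ< m (size ∘ suc)                              ∎
  where open ≡-Reasoning

-- The bound for each residue of n modulo 10.

module Residue {n : ℕ} (r′ k τ ν : ℕ) (n≡ : n ≡ 2 + r′ + k * 10) (3≤n : 3 ≤ n) (τ≤1 : τ ≤ 1)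
  (Layered : Set) (layered⇒ : Layered → 10 ≤ n × (5 ∣ n ⊎ 5 ∣ 3 + n))
  (5∣ν+r : 5 ∣ ν + (2 + r′)) (2∣1+ν+τ : 2 ∣ 1 + ν + τ) where

  open Strands {r = 2 + r′} {k} n≡ 3≤n τ≤1 Layered layered⇒ public
  open Separation 3≤n Layered layered⇒ public using (Weight; bulk; row₁; row₁′; row₂)

  bulk-strand : ∀ {e} → (Layered → 4 ≤ e) → Strand e (start-column ν e)
  bulk-strand {e} high = record
    { γ≤r+9  = ≤-trans (m%n<n (e * 3 + ν) 10) (+-monoˡ-≤ 9 (s≤s (z≤n {1 + r′})))
    ; weight = λ u γ≤u → bulk (≤-trans z<s γ≤u) high
    ; 5∣     = subst (5 ∣_) (sym (+-assoc (start-column ν e) (e + e) (n + 4)))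
                 (∣-start-column ν e (e + e + (n + 4)) (divides 2 refl)
                   (subst (5 ∣_) regroup₅ (∣m∣n⇒∣m+n 5∣ν+r (m∣m*n (1 + e + k + k)))))
    ; 2∣     = subst (2 ∣_) (sym (+-assoc (start-column ν e) τ e))
                 (∣-start-column ν e (τ + e) (divides 5 refl)
                   (subst (2 ∣_) regroup₂ (∣m∣n⇒∣m+n 2∣1+ν+τ (m∣m*n (e + e)))))
    }
    where
    regroup₅ : ν + (2 + r′) + 5 * (1 + e + k + k) ≡ 1 + (e * 3 + ν) + (e + e + (n + 4))
    regroup₅ = cancel-by (sym n≡) (solve (ν ∷ r′ ∷ e ∷ k ∷ n ∷ []))

    regroup₂ : 1 + ν + τ + 2 * (e + e) ≡ 1 + (e * 3 + ν) + (τ + e)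
    regroup₂ = solve (ν ∷ τ ∷ e ∷ [])

  module Rows (starts : ℕ → List ℕ)
    (strands  : ∀ {e} → 0 < e → e < n → All (Strand e) (starts e))
    (distinct : ∀ e → AllPairs (λ γ γ′ → γ % 10 ≢ γ′ % 10) (starts e)) where

    row-size : ℕ → ℕ
    row-size e = sum (map points (starts e))

    length-row : ∀ e → length (row starts e) ≡ row-size e
    length-row e = trans (length-concatMap (strand e) (starts e))
                         (cong sum (map-cong (λ γ → length-applyUpTo _ (points γ)) (starts e)))

    length-cells : length (cells starts) ≡ Σ< (n ∸ 1) (row-size ∘ suc)
    length-cells = length-rows (row starts) row-size length-row (n ∸ 1)

    Σ-row-size≤ρ : Σ< (n ∸ 1) (row-size ∘ suc) ≤ ρ (F₂ (C n 3≤n))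
    Σ-row-size≤ρ = packing⇒≤ρ 3≤n length-cells (strands-packing starts strands distinct)

-- The number of code cells that row 1 + h + i has in the columns below r.
profile : ℕ → ℕ → ℕ → ℕ → ℕ
profile r ν h i = count r (start-column ν (1 + h + i))

-- The premise reflects that every column from 1 to `r - 1` meets ten consecutive rows in exactly
-- one cell of the code lattice.
Σ<-profile : ∀ r ν h m k → Σ< 10 (profile r ν h) ≡ r ∸ 1 →
             Σ< (m + k * 10) (λ i → profile r ν h i + k + 0) ≡
             (m + k * 10) * k + (k * (r ∸ 1) + Σ< m (profile r ν h))
Σ<-profile r ν h m k total = begin
  Σ< (m + k * 10) (λ i → g i + k + 0)                    ≡⟨ Σ<-cong (m + k * 10) (λ i → +-identityʳ (g i + k)) ⟩
  Σ< (m + k * 10) (λ i → g i + k)                        ≡⟨ Σ<-+-const (m + k * 10) k g ⟩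
  (m + k * 10) * k + Σ< (m + k * 10) g                   ≡⟨ cong ((m + k * 10) * k +_) (Σ<-periodic m k g periodic) ⟩
  (m + k * 10) * k + (k * Σ< 10 g + Σ< m g)              ≡⟨ cong (λ x → (m + k * 10) * k + (k * x + Σ< m g)) total ⟩
  (m + k * 10) * k + (k * (r ∸ 1) + Σ< m g)              ∎
  where
  open ≡-Reasoning
  g = profile r ν h

  periodic : ∀ i → g (10 + i) ≡ g i
  periodic i = cong (count r) (trans (cong (start-column ν) (shift h i)) (start-column-periodic ν (1 + h + i)))
    where
    shift : ∀ h i → 1 + h + (10 + i) ≡ 10 + (1 + h + i)
    shift h i = x∙yz≈y∙xz (1 + h) 10 i

Bound : ∀ n → 3 ≤ n → Set
Bound n 3≤n = (n * (n ∸ 2)) / 10 + 1 ≤ ρ (F₂ (C n 3≤n))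

-- The implicit premises do not involve `k`, so they are closed for literal `r′`, `τ`, `ν` and are
-- decided by evaluation.
plain-bound : ∀ {n} r′ k τ ν → n ≡ 2 + r′ + k * 10 → (3≤n : 3 ≤ n)
        {_ : True (τ ≤? 1)} {_ : True (5 ∣? ν + (2 + r′))} {_ : True (2 ∣? 1 + ν + τ)}
        {_ : True (Σ< 10 (profile (2 + r′) ν 0) ≟ 1 + r′)}
        {_ : True ((2 + r′) * r′ / 10 + 1 ≤? Σ< (1 + r′) (profile (2 + r′) ν 0))} →
        Bound n 3≤n
plain-bound {n} r′ k τ ν n≡ 3≤n {τ≤1} {5∣} {2∣} {total} {large} =
  ≤-trans (quotient-bound r′ k _ n≡ (toWitness large)) (≤-trans (≤-reflexive (sym sizes)) Σ-row-size≤ρ)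
  where
  open Residue r′ k τ ν n≡ 3≤n (toWitness τ≤1) ⊥ (λ ()) (toWitness 5∣) (toWitness 2∣)
  open Rows (λ e → start-column ν e ∷ []) (λ _ _ → bulk-strand (λ ()) All.∷ All.[])
            (λ _ → All.[] AllPairs.∷ AllPairs.[])

  sizes : Σ< (n ∸ 1) (row-size ∘ suc) ≡
          (1 + r′ + k * 10) * k + (k * (1 + r′) + Σ< (1 + r′) (profile (2 + r′) ν 0))
  sizes = trans (cong (λ x → Σ< x (row-size ∘ suc)) (cong pred n≡))
                (Σ<-profile (2 + r′) ν 0 (1 + r′) k (toWitness total))

-- The conditions of a `Strand` with `n` reduced to `r`; the summand 1 is `τ`, which is fixed for
-- the layered code.
Start : (r e w γ : ℕ) → Set
Start r e w γ = γ ≤ r + 9 × 5 ∣ γ + w + (r + 4) × 2 ∣ γ + 1 + e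

start? : ∀ r e w γ → Dec (Start r e w γ)
start? r e w γ = γ ≤? r + 9 ×-dec 5 ∣? γ + w + (r + 4) ×-dec 2 ∣? γ + 1 + e

layered-bound : ∀ {n} σ k ν a b c → n ≡ 4 + σ + k * 10 → (3≤n : 3 ≤ n)
          {_ : True (10 ≤? 4 + σ)} {_ : True (5 ∣? 4 + σ ⊎-dec 5 ∣? 3 + (4 + σ))}
          {_ : True (5 ∣? ν + (4 + σ))} {_ : True (2 ∣? 1 + ν + 1)}
          {_ : True (start? (4 + σ) 1 0 (suc a))}
          {_ : True (start? (4 + σ) 1 4 b)} {_ : True (start? (4 + σ) 2 2 (suc c))}
          {_ : False (suc a % 10 ≟ b % 10)}
          {_ : True (Σ< 10 (profile (4 + σ) ν 3) ≟ 3 + σ)}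
          {_ : True ((4 + σ) * (2 + σ) / 10 + 1 ≤?
                     count (4 + σ) (suc a) + count (4 + σ) b + count (4 + σ) (suc c) + Σ< σ (profile (4 + σ) ν 3))} →
          Bound n 3≤n
layered-bound {n} σ k ν a b c n≡ 3≤n {10≤r} {5∣r} {5∣ν+r} {2∣1+ν+τ}
        {start-a} {start-b} {start-c} {a≢b} {total} {large} =
  ≤-trans (quotient-bound (2 + σ) k _ n≡ (toWitness large)) (≤-trans (≤-reflexive (sym sizes)) Σ-row-size≤ρ)
  where
  r = 4 + σ

  5∣k*10 : 5 ∣ k * 10
  5∣k*10 = ∣n⇒∣m*n k (divides 2 refl)

  layered⇒ : ⊤ → 10 ≤ n × (5 ∣ n ⊎ 5 ∣ 3 + n)
  layered⇒ _ = subst (λ n → 10 ≤ n × (5 ∣ n ⊎ 5 ∣ 3 + n)) (sym n≡)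
    ( ≤-trans (toWitness 10≤r) (m≤m+n r (k * 10))
    , Sum.map (λ 5∣ → ∣m∣n⇒∣m+n 5∣ 5∣k*10) (λ 5∣ → ∣m∣n⇒∣m+n 5∣ 5∣k*10) (toWitness 5∣r))

  open Residue (2 + σ) k 1 ν n≡ 3≤n (s≤s z≤n) ⊤ layered⇒ (toWitness 5∣ν+r) (toWitness 2∣1+ν+τ)

  -- Row 3 is empty because its strand has moved to row 1. Only the start `b` may be 0.
  starts : ℕ → List ℕ
  starts 1 = suc a ∷ b ∷ []
  starts 2 = suc c ∷ []
  starts 3 = []
  starts e = start-column ν e ∷ []

  start-strand : ∀ {e w γ} → Start r e w γ → (∀ u → γ ≤ u → Weight u e w) → Strand e γ
  start-strand {e} {w} {γ} (γ≤ , 5∣ , 2∣) weight = record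
    { γ≤r+9 = γ≤ ; weight = weight ; 2∣ = 2∣
    ; 5∣ = subst (5 ∣_) (extend γ w (k * 10) n≡) (∣m∣n⇒∣m+n 5∣ 5∣k*10) }
    where
    extend : ∀ {n r} γ w x → n ≡ r + x → γ + w + (r + 4) + x ≡ γ + w + (n + 4)
    extend {r = r} γ w x refl = trans (+-assoc (γ + w) (r + 4) x) (cong (γ + w +_) (xy∙z≈xz∙y r 4 x))

  strands : ∀ {e} → 0 < e → e < n → All (Strand e) (starts e)
  strands {1} _ _ = start-strand (toWitness start-a) (λ _ a≤u → row₁ tt (≤-trans z<s a≤u))
                  All.∷ start-strand (toWitness start-b) (λ _ _ → row₁′ tt) All.∷ All.[]
  strands {2} _ _ = start-strand (toWitness start-c) (λ _ c≤u → row₂ tt (≤-trans z<s c≤u)) All.∷ All.[]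
  strands {3} _ _ = All.[]
  strands {suc (suc (suc (suc e)))} _ _ = bulk-strand (λ _ → s≤s (s≤s (s≤s (s≤s z≤n)))) All.∷ All.[]

  distinct : ∀ e → AllPairs (λ γ γ′ → γ % 10 ≢ γ′ % 10) (starts e)
  distinct 0 = All.[] AllPairs.∷ AllPairs.[]
  distinct 1 = (toWitnessFalse a≢b All.∷ All.[]) AllPairs.∷ All.[] AllPairs.∷ AllPairs.[]
  distinct 2 = All.[] AllPairs.∷ AllPairs.[]
  distinct 3 = AllPairs.[]
  distinct (suc (suc (suc (suc e)))) = All.[] AllPairs.∷ AllPairs.[]

  open Rows starts strands distinct

  sizes : Σ< (n ∸ 1) (row-size ∘ suc) ≡
          (3 + σ + k * 10) * k + (k * (3 + σ) +
            (count r (suc a) + count r b + count r (suc c) + Σ< σ (profile r ν 3)))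
  -- Rows 1 to 3 split off by computation; the remaining `σ + k * 10` rows are bulk rows, hence the
  -- shift 3 in `profile`.
  sizes = begin
    Σ< (n ∸ 1) (row-size ∘ suc)
      ≡⟨ cong (λ x → Σ< x (row-size ∘ suc)) (cong pred n≡) ⟩
    row-size 1 + (row-size 2 + (0 + Σ< (σ + k * 10) (λ i → row-size (4 + i))))
      ≡⟨ cong (λ x → row-size 1 + (row-size 2 + x)) (Σ<-profile r ν 3 σ k (toWitness total)) ⟩
    row-size 1 + (row-size 2 + ((σ + k * 10) * k + (k * (3 + σ) + Σ< σ (profile r ν 3))))
      ≡⟨ collect-rows k (count r (suc a)) (count r b) (count r (suc c)) (σ + k * 10) (k * (3 + σ)) (Σ< σ (profile r ν 3)) ⟩
    (3 + σ + k * 10) * k + (k * (3 + σ) +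
      (count r (suc a) + count r b + count r (suc c) + Σ< σ (profile r ν 3))) ∎
    where open ≡-Reasoning

theorem2 : ∀ (n : ℕ) (3≤n : 3 ≤ n) →
    ρ (F₂ (C n 3≤n)) ≥ (n * (n ∸ 2)) / 10 + 1
-- Dividing `n - 3` gives the representatives 3 to 12, so the two layered cases have `n ≥ 10`.
theorem2 n 3≤n with (n ∸ 3) divMod 10
... | result k t n∸3≡ = by-residue t (trans (sym (m+[n∸m]≡n 3≤n)) (cong (3 +_) n∸3≡))
  where
  by-residue : ∀ t → n ≡ 3 + (toℕ t + k * 10) → Bound n 3≤n
  -- Given `τ`, the last digit `ν` is forced: it is minus the residue of `n` modulo 5, and its
  -- parity is opposite to that of `τ`.
  by-residue 0F n≡ = plain-bound 1 k 0 7 n≡ 3≤n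
  by-residue 1F n≡ = plain-bound 2 k 0 1 n≡ 3≤n
  by-residue 2F n≡ = plain-bound 3 k 1 0 n≡ 3≤n
  by-residue 3F n≡ = plain-bound 4 k 0 9 n≡ 3≤n
  by-residue 4F n≡ = plain-bound 5 k 1 8 n≡ 3≤n
  by-residue 5F n≡ = plain-bound 6 k 0 7 n≡ 3≤n
  by-residue 6F n≡ = plain-bound 7 k 0 1 n≡ 3≤n
  -- Here `r` is 10. Bulk rows 1 to 3 would start in columns 4, 7 and 10, the last of which is not
  -- below 10; the layered starts 6, 2 and 9 all are.
  by-residue 7F n≡ = layered-bound 6 k 0 5 2 8 n≡ 3≤n
  by-residue 8F n≡ = plain-bound 9 k 0 9 n≡ 3≤n
  -- Here `r` is 12. The strand starting in column 0 has two cells below column 12, namely in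
  -- columns 0 and 10, which is the extra cell.
  by-residue 9F n≡ = layered-bound 8 k 8 3 0 6 n≡ 3≤n
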